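{- Let $r>t\geq 2$ be integers and let $n\geq (r-1)\left\lfloor\frac{r-2}{t-1}\right\rfloor+2$. Then in every edge coloring of $K_n^r$ with $\left\lfloor\frac{r-2}{t-1}\right\rfloor$ colors there is a monochromatic Hamiltonian $t$-tight Berge-cycle.
   Context: $K_n^r$ denotes the complete $r$-uniform hypergraph on $n$ vertices. For $r\geq t\geq 2$, an $r$-uniform $t$-tight Berge-cycle of length $n$ in an $r$-uniform hypergraph consists of a sequence of distinct vertices $v_1,\dots,v_n$ (the core sequence) together with distinct edges $e_1,\dots,e_n$ such that $e_j$ contains $v_j,v_{j+1},\dots,v_{j+t-1}$ (indices modulo $n$). It is Hamiltonian if $n$ equals the number of vertices of the hypergraph, and monochromatic if all of $e_1,\dots,e_n$ have the same color. -}

module Defs where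

open import Data.Nat using (ℕ; zero; suc; _+_; _*_; _∸_; _/_; _%_; _<_; _≤_)
open import Data.Nat.DivMod using (m%n<n)
open import Data.Fin using (Fin; toℕ; fromℕ<)
open import Data.Fin.Subset using (Subset; _∈_; ∣_∣)
open import Data.Product using (Σ; _×_; _,_; proj₁)
open import Function.Definitions using (Injective)
open import Relation.Binary.PropositionalEquality using (_≡_)

Edge : (n r : ℕ) → Set
Edge n r = Σ (Subset n) (λ e → ∣ e ∣ ≡ r)

Colouring : (n r k : ℕ) → Set
Colouring n r k = Edge n r → Fin k

_⊕_ : ∀ {n} → Fin n → ℕ → Fin n
_⊕_ {suc m} j i = fromℕ< (m%n<n (toℕ j + i) (suc m))

record MonoHamBergeCycle (n r t k : ℕ) (χ : Colouring n r k) : Set where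
  field
    colour : Fin k
    core   : Fin n → Fin n
    edges  : Fin n → Edge n r
    core-distinct  : Injective _≡_ _≡_ core
    edges-distinct : Injective _≡_ _≡_ edges
    tight  : ∀ (j : Fin n) (i : ℕ) → i < t → core (j ⊕ i) ∈ proj₁ (edges j)
    mono   : ∀ (j : Fin n) → χ (edges j) ≡ colour

-- ⌊(r-2)/(t-1)⌋ for t ≥ 2 (written with divisor suc (t ∸ 2) = t - 1).
numColours : ℕ → ℕ → ℕ
numColours r t = (r ∸ 2) / suc (t ∸ 2)

{-# OPTIONS --safe #-}
module Submission where

open import Defs
open import Data.Bool using (Bool; true; false; if_then_else_)
import Data.Bool.Properties as Bool
open import Data.Empty using (⊥-elim)
open import Data.Fin using (Fin; zero; suc; toℕ)
import Data.Fin.Properties as Fin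
open import Data.Fin.Properties using (toℕ-fromℕ<; toℕ-injective; toℕ<n)
import Data.Fin.Subset as Subset
open import Data.Fin.Subset using (Subset; Nonempty; ⊥; ∣_∣; _∪_; ⁅_⁆; ∁; _-_; _∈_; _∉_; _⊆_)
open import Data.Fin.Subset.Properties
  using (_∈?_; _⊆?_; anySubset?; nonempty?; Empty-unique; ⊆-trans; ⊆⊤; in⊆in; out⊆; ∣p∣≤n; ∣⊥∣≡0; ∣⊤∣≡n; ∣⁅x⁆∣≡1; ∣∁p∣≡n∸∣p∣; p⊆q⇒∣p∣≤∣q∣; p⊂q⇒∣p∣<∣q∣; x∉p⇒x∈∁p; x∈⁅x⁆; x∈⁅y⁆⇒x≡y; p⊆p∪q; q⊆p∪q; x∈p∪q⁺; x∈p∪q⁻; x∈p⇒∣p-x∣<∣p∣; x∈p∧x≢y⇒x∈p-y)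
open import Data.List using (List; []; _∷_; _++_; [_]; map; length; allFin; tabulate; reverse)
open import Data.List.Extrema.Nat using (argmin; f[argmin]≤f[xs])
import Data.List.Membership.DecPropositional as DecMembership
open import Data.List.Membership.Propositional using (find; lose) renaming (_∈_ to _∈ˡ_)
open import Data.List.Membership.Propositional.Properties using (∈-∃++; ∈-++⁻; ∈-++⁺ˡ; ∈-++⁺ʳ; ∈-allFin; ∈-map⁻; ∈-map⁺)
open import Data.List.Properties using (map-tabulate; unfold-reverse; ++-assoc; length-++; length-map; length-tabulate)
open import Data.List.Relation.Binary.Permutation.Propositional using (_↭_; ↭-sym; ↭-trans; ↭-refl; ↭-reflexive; ↭⇒↭ₛ; prep)
open import Data.List.Relation.Binary.Permutation.Propositional.Properties using (∈-resp-↭; ↭-length; ↭-reverse; ++⁺ˡ; ++-comm)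
import Data.List.Relation.Binary.Permutation.Setoid.Properties as ↭ₛ
open import Data.List.Relation.Unary.All as All using (All; []; _∷_)
open import Data.List.Relation.Unary.AllPairs using ([]; _∷_)
import Data.List.Relation.Unary.Any as Any
open import Data.List.Relation.Unary.Any using (here; there)
open import Data.List.Relation.Unary.Linked using (Linked; _∷_)
open import Data.List.Relation.Unary.Unique.Propositional using (Unique)
open import Data.List.Relation.Unary.Unique.Propositional.Properties using (allFin⁺; map⁺; ++⁺)
open import Data.List.Sort using (sort; sort-↭; sort-↗)
open import Data.Nat using (ℕ; zero; suc; _+_; _*_; _∸_; _<_; _≤_; z≤n; s≤s; _≤?_; _<?_)
open import Data.Nat.DivMod using (_%_; m%n<n; %-distribˡ-+; [m+n]%n≡m%n; m<n⇒m%n≡m; m%n%n≡m%n; n%n≡0; m/n*n≤m; m≥n⇒m/n>0)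
open import Data.Nat.Properties
open import Data.Nat.Tactic.RingSolver using (solve-∀)
open import Data.Product using (∃; Σ; _×_; _,_; proj₁; proj₂)
open import Data.Sum as Sum using (_⊎_; inj₁; inj₂; [_,_]′)
import Data.Vec as Vec
open import Data.Vec using ([]; _∷_)
open import Data.Vec.Properties using ([]=⇒lookup; lookup⇒[]=; lookup∘tabulate; ∷-injectiveʳ; ≡-dec)
open import Function using (_∘_; id; case_of_)
open import Function.Definitions using (Injective)
open import Level using (0ℓ)
import Relation.Binary.Construct.On as On
open import Relation.Binary.Definitions using (DecidableEquality)
open import Relation.Binary.PropositionalEquality using (_≡_; _≢_; refl; sym; trans; cong; cong₂; subst; setoid; module ≡-Reasoning)
open import Relation.Nullary using (Dec; yes; no; ¬_; does)
open import Relation.Nullary.Decidable using (dec-true; decidable-stable; map′; ¬?; _×-dec_; _⊎-dec_)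
open import Relation.Unary using (Pred; Decidable)

-- Let c be the number of colours. Call a set T of at most t vertices good for a colour if more than
-- r − t edges of that colour contain T. An r-set contains at most r − t + 1 windows of t consecutive
-- vertices of a cyclic order of all n > r vertices, so if all windows are good for one colour, Hall's
-- theorem (in degree form) assigns them distinct edges of that colour. Let Gᵢ be the graph of the
-- pairs all of whose t-supersets are good for i; a Hamiltonian cycle of Gᵢ is such a cyclic order.
--
-- If no Gᵢ is Hamiltonian, some W of at most c + 1 vertices contains a non-edge of every Gᵢ. Pass to
-- the Bondy–Chvátal closure, where non-adjacent vertices have degree sum below n, and let Lᵢ be the
-- set of non-neighbours of a vertex vᵢ of minimum degree: 2|Lᵢ| ≥ n − 1 and all degrees in Lᵢ are at
-- most |Lᵢ|. With the colours sorted by |Lᵢ|, a vertex of Lᵢ is non-adjacent in Gᵢ to some vertex of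
-- the next Lⱼ, unless its neighbourhood is exactly Lⱼ; so the non-edges form a path on c + 1 vertices,
-- the exceptional steps being repaired with the help of vⱼ.
--
-- Adding to W a bad set around each non-edge gives a set U of at most c(t − 1) + 1 < r vertices. At
-- least n − |U| > c(r − t) edges contain U, but at most r − t of them have any given colour.

private
  variable
    A B : Set
    n : ℕ

-- Sums over lists

∑ : (A → ℕ) → List A → ℕ
∑ f []       = 0
∑ f (x ∷ xs) = f x + ∑ f xs

ι : Bool → ℕ
ι true  = 1
ι false = 0

ι≤1 : ∀ b → ι b ≤ 1
ι≤1 true  = ≤-refl
ι≤1 false = z≤n

∑-++ : ∀ (f : A → ℕ) xs ys → ∑ f (xs ++ ys) ≡ ∑ f xs + ∑ f ys
∑-++ f []       ys = refl
∑-++ f (x ∷ xs) ys = trans (cong (f x +_) (∑-++ f xs ys)) (sym (+-assoc (f x) _ _))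

∑-extract : ∀ (f : A → ℕ) xs y ys → ∑ f (xs ++ y ∷ ys) ≡ f y + ∑ f (xs ++ ys)
∑-extract f []       y ys = refl
∑-extract f (x ∷ xs) y ys = begin
  f x + ∑ f (xs ++ y ∷ ys)     ≡⟨ cong (f x +_) (∑-extract f xs y ys) ⟩
  f x + (f y + ∑ f (xs ++ ys)) ≡⟨ +-assoc (f x) _ _ ⟨
  f x + f y + ∑ f (xs ++ ys)   ≡⟨ cong (_+ ∑ f (xs ++ ys)) (+-comm (f x) (f y)) ⟩
  f y + f x + ∑ f (xs ++ ys)   ≡⟨ +-assoc (f y) _ _ ⟩
  f y + (f x + ∑ f (xs ++ ys)) ∎
  where open ≡-Reasoning

∑-mono : ∀ {f g : A → ℕ} xs → (∀ {x} → x ∈ˡ xs → f x ≤ g x) → ∑ f xs ≤ ∑ g xs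
∑-mono []       f≤g = z≤n
∑-mono (x ∷ xs) f≤g = +-mono-≤ (f≤g (here refl)) (∑-mono xs (f≤g ∘ there))

∑-mono-< : ∀ {f g : A → ℕ} {xs x} → (∀ x → f x ≤ g x) → x ∈ˡ xs → f x < g x → ∑ f xs < ∑ g xs
∑-mono-< {xs = _ ∷ xs} f≤g (here refl) fx<gx = +-mono-<-≤ fx<gx (∑-mono xs (λ _ → f≤g _))
∑-mono-< {xs = y ∷ _}  f≤g (there x∈)  fx<gx = +-mono-≤-< (f≤g y) (∑-mono-< f≤g x∈ fx<gx)

∑-∈ : ∀ (f : A → ℕ) {xs x} → x ∈ˡ xs → f x ≤ ∑ f xs
∑-∈ f {xs = x ∷ xs} (here refl) = m≤m+n (f x) _
∑-∈ f {xs = y ∷ _}  (there x∈)  = ≤-trans (∑-∈ f x∈) (m≤n+m _ (f y))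

∑-positive : ∀ (f : A → ℕ) xs → 0 < ∑ f xs → ∃ λ x → x ∈ˡ xs × 0 < f x
∑-positive f (x ∷ xs) 0<∑ with f x in eq
... | suc _ = x , here refl , subst (0 <_) (sym eq) (s≤s z≤n)
... | zero with ∑-positive f xs 0<∑
...   | y , y∈ , 0<fy = y , there y∈ , 0<fy

∑-one : ∀ (xs : List A) → ∑ (λ _ → 1) xs ≡ length xs
∑-one []       = refl
∑-one (x ∷ xs) = cong suc (∑-one xs)

∑-≤-* : ∀ (f : A → ℕ) d xs → (∀ {x} → x ∈ˡ xs → f x ≤ d) → ∑ f xs ≤ length xs * d
∑-≤-* f d []       f≤d = z≤n
∑-≤-* f d (x ∷ xs) f≤d = +-mono-≤ (f≤d (here refl)) (∑-≤-* f d xs (f≤d ∘ there))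

∑-≥-* : ∀ (f : A → ℕ) d xs → (∀ x → d ≤ f x) → length xs * d ≤ ∑ f xs
∑-≥-* f d []       d≤f = z≤n
∑-≥-* f d (x ∷ xs) d≤f = +-mono-≤ (d≤f x) (∑-≥-* f d xs d≤f)

∑-+ : ∀ (f g : A → ℕ) xs → ∑ (λ x → f x + g x) xs ≡ ∑ f xs + ∑ g xs
∑-+ f g []       = refl
∑-+ f g (x ∷ xs) = begin
  f x + g x + ∑ (λ x → f x + g x) xs ≡⟨ cong (f x + g x +_) (∑-+ f g xs) ⟩
  f x + g x + (∑ f xs + ∑ g xs)      ≡⟨ +-assoc (f x) _ _ ⟩
  f x + (g x + (∑ f xs + ∑ g xs))    ≡⟨ cong (f x +_) (+-assoc (g x) _ _) ⟨
  f x + (g x + ∑ f xs + ∑ g xs)      ≡⟨ cong (λ z → f x + (z + ∑ g xs)) (+-comm (g x) _) ⟩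
  f x + (∑ f xs + g x + ∑ g xs)      ≡⟨ cong (f x +_) (+-assoc (∑ f xs) _ _) ⟩
  f x + (∑ f xs + (g x + ∑ g xs))    ≡⟨ +-assoc (f x) _ _ ⟨
  f x + ∑ f xs + (g x + ∑ g xs)      ∎
  where open ≡-Reasoning

∑-zero : ∀ (xs : List A) → ∑ (λ _ → 0) xs ≡ 0
∑-zero []       = refl
∑-zero (x ∷ xs) = ∑-zero xs

∑-swap : ∀ (f : A → B → ℕ) xs ys →
         ∑ (λ x → ∑ (f x) ys) xs ≡ ∑ (λ y → ∑ (λ x → f x y) xs) ys
∑-swap f []       ys = sym (∑-zero ys)
∑-swap f (x ∷ xs) ys =
  trans (cong (∑ (f x) ys +_) (∑-swap f xs ys)) (sym (∑-+ (f x) (λ y → ∑ (λ z → f z y) xs) ys))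

∑-map : ∀ (f : B → ℕ) (g : A → B) xs → ∑ f (map g xs) ≡ ∑ (f ∘ g) xs
∑-map f g []       = refl
∑-map f g (x ∷ xs) = cong (f (g x) +_) (∑-map f g xs)

-- Each entry of `xs` with a nonzero value uses up one occurrence in `ys`, and `Unique xs` prevents
-- it from being called for again. This allows sums over duplicate-free lists to be compared without
-- multiset reasoning.
∑-support : ∀ (f : A → ℕ) {xs} → Unique xs → ∀ ys →
            (∀ {x} → x ∈ˡ xs → 0 < f x → x ∈ˡ ys) → ∑ f xs ≤ ∑ f ys
∑-support f []           ys sup = z≤n
∑-support f {x ∷ xs} (x∉ ∷ uq) ys sup with f x in eq
... | zero  = ∑-support f uq ys (sup ∘ there)
... | suc k with ∈-∃++ (sup (here refl) (subst (0 <_) (sym eq) (s≤s z≤n)))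
...   | as , bs , refl = begin
  suc k + ∑ f xs         ≡⟨ cong (_+ ∑ f xs) eq ⟨
  f x + ∑ f xs           ≤⟨ +-monoʳ-≤ (f x) (∑-support f uq (as ++ bs) sup′) ⟩
  f x + ∑ f (as ++ bs)   ≡⟨ ∑-extract f as x bs ⟨
  ∑ f (as ++ x ∷ bs)     ∎
  where
  open ≤-Reasoning
  sup′ : ∀ {y} → y ∈ˡ xs → 0 < f y → y ∈ˡ as ++ bs
  sup′ y∈ 0<f with ∈-++⁻ as (sup (there y∈) 0<f)
  ... | inj₁ y∈as         = ∈-++⁺ˡ y∈as
  ... | inj₂ (here refl)  = ⊥-elim (All.lookup x∉ y∈ refl)
  ... | inj₂ (there y∈bs) = ∈-++⁺ʳ as y∈bs

unique-⊆⇒length≤ : ∀ {xs : List A} → Unique xs → ∀ ys → (∀ {x} → x ∈ˡ xs → x ∈ˡ ys) → length xs ≤ length ys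
unique-⊆⇒length≤ {xs = xs} uq ys xs⊆ys = begin
  length xs         ≡⟨ ∑-one xs ⟨
  ∑ (λ _ → 1) xs    ≤⟨ ∑-support (λ _ → 1) uq ys (λ x∈ _ → xs⊆ys x∈) ⟩
  ∑ (λ _ → 1) ys    ≡⟨ ∑-one ys ⟩
  length ys         ∎
  where open ≤-Reasoning

-- Indicators and cardinalities of subsets.

𝟙 : Subset n → Fin n → ℕ
𝟙 S x = ι (Vec.lookup S x)

𝟙-∈ : ∀ {S : Subset n} {x} → x ∈ S → 𝟙 S x ≡ 1
𝟙-∈ x∈S = cong ι ([]=⇒lookup x∈S)

𝟙-∉ : ∀ {S : Subset n} {x} → x ∉ S → 𝟙 S x ≡ 0
𝟙-∉ {S = S} {x} x∉S with Vec.lookup S x in eq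
... | true  = ⊥-elim (x∉S (lookup⇒[]= x S eq))
... | false = refl

∑-tabulate : ∀ (f : A → ℕ) (g : Fin n → A) → ∑ f (tabulate g) ≡ ∑ (f ∘ g) (allFin n)
∑-tabulate f g = trans (cong (∑ f) (sym (map-tabulate id g))) (∑-map f g (allFin _))

∑-𝟙 : ∀ (S : Subset n) → ∑ (𝟙 S) (allFin n) ≡ ∣ S ∣
∑-𝟙 Vec.[] = refl
∑-𝟙 (true  Vec.∷ S) = cong suc (trans (∑-tabulate (𝟙 (true Vec.∷ S)) suc) (∑-𝟙 S))
∑-𝟙 (false Vec.∷ S) = trans (∑-tabulate (𝟙 (false Vec.∷ S)) suc) (∑-𝟙 S)

∣∪∣≤ : ∀ (p q : Subset n) → ∣ p ∪ q ∣ ≤ ∣ p ∣ + ∣ q ∣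
∣∪∣≤ Vec.[] Vec.[] = z≤n
∣∪∣≤ (true  Vec.∷ p) (true  Vec.∷ q) = s≤s (≤-trans (∣∪∣≤ p q) (+-monoʳ-≤ ∣ p ∣ (n≤1+n _)))
∣∪∣≤ (true  Vec.∷ p) (false Vec.∷ q) = s≤s (∣∪∣≤ p q)
∣∪∣≤ (false Vec.∷ p) (true  Vec.∷ q) = ≤-trans (s≤s (∣∪∣≤ p q)) (≤-reflexive (sym (+-suc ∣ p ∣ _)))
∣∪∣≤ (false Vec.∷ p) (false Vec.∷ q) = ∣∪∣≤ p q

∣⁅x⁆∪∣≤ : ∀ (x : Fin n) q → ∣ ⁅ x ⁆ ∪ q ∣ ≤ suc ∣ q ∣
∣⁅x⁆∪∣≤ x q = ≤-trans (∣∪∣≤ ⁅ x ⁆ q) (≤-reflexive (cong (_+ ∣ q ∣) (∣⁅x⁆∣≡1 x)))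

⟦_⟧ : {P : Pred (Fin n) 0ℓ} → Decidable P → Subset n
⟦ P? ⟧ = Vec.tabulate (does ∘ P?)

∈⟦⟧⁺ : ∀ {P : Pred (Fin n) 0ℓ} (P? : Decidable P) {x} → P x → x ∈ ⟦ P? ⟧
∈⟦⟧⁺ P? {x} px = lookup⇒[]= x ⟦ P? ⟧ (trans (lookup∘tabulate (does ∘ P?) x) (dec-true (P? x) px))

∈⟦⟧⁻ : ∀ {P : Pred (Fin n) 0ℓ} (P? : Decidable P) {x} → x ∈ ⟦ P? ⟧ → P x
∈⟦⟧⁻ P? {x} x∈ with P? x | trans (sym (lookup∘tabulate (does ∘ P?) x)) ([]=⇒lookup x∈)
... | yes px | _ = px

𝟙-⟦⟧ : ∀ {P : Pred (Fin n) 0ℓ} (P? : Decidable P) x → 𝟙 ⟦ P? ⟧ x ≡ ι (does (P? x))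
𝟙-⟦⟧ P? x = cong ι (lookup∘tabulate (does ∘ P?) x)

-- Bondy–Chvátal closure

record Graph (n : ℕ) : Set where
  field
    nbr     : Fin n → Subset n
    nbr-sym : ∀ {u v} → v ∈ nbr u → u ∈ nbr v
    nbr-irr : ∀ {u} → u ∉ nbr u

  deg : Fin n → ℕ
  deg u = ∣ nbr u ∣

  gap : Fin n → Fin n → ℕ
  gap u v = 1 ∸ 𝟙 (nbr u) v

  gap-∈ : ∀ {u v} → v ∈ nbr u → gap u v ≡ 0
  gap-∈ v∈ = cong (1 ∸_) (𝟙-∈ v∈)

  gap-∉ : ∀ {u v} → v ∉ nbr u → gap u v ≡ 1
  gap-∉ v∉ = cong (1 ∸_) (𝟙-∉ v∉)

  gap≡0⇒∈ : ∀ {u v} → gap u v ≡ 0 → v ∈ nbr u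
  gap≡0⇒∈ {u} {v} eq with v ∈? nbr u
  ... | yes v∈ = v∈
  ... | no  v∉ = ⊥-elim (1+n≢0 (trans (sym (gap-∉ v∉)) eq))

  gap-sym : ∀ u v → gap u v ≡ gap v u
  gap-sym u v with v ∈? nbr u
  ... | yes v∈ = trans (gap-∈ v∈) (sym (gap-∈ (nbr-sym v∈)))
  ... | no  v∉ = trans (gap-∉ v∉) (sym (gap-∉ (v∉ ∘ nbr-sym)))

  -- Both ends are separate arguments, so a walk splits additively at any inner vertex, and equal
  -- ends give a cyclic order.
  gaps : Fin n → List (Fin n) → Fin n → ℕ
  gaps a []      z = gap a z
  gaps a (b ∷ l) z = gap a b + gaps b l z

  gaps-++ : ∀ a l b l′ z → gaps a (l ++ b ∷ l′) z ≡ gaps a l b + gaps b l′ z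
  gaps-++ a []      b l′ z = refl
  gaps-++ a (c ∷ l) b l′ z = trans (cong (gap a c +_) (gaps-++ c l b l′ z)) (sym (+-assoc (gap a c) _ _))

  gaps-reverse : ∀ a l z → gaps z (reverse l) a ≡ gaps a l z
  gaps-reverse a []      z = gap-sym z a
  gaps-reverse a (b ∷ l) z = begin
    gaps z (reverse (b ∷ l)) a      ≡⟨ cong (λ k → gaps z k a) (unfold-reverse b l) ⟩
    gaps z (reverse l ++ [ b ]) a   ≡⟨ gaps-++ z (reverse l) b [] a ⟩
    gaps z (reverse l) b + gap b a  ≡⟨ cong₂ _+_ (gaps-reverse b l z) (gap-sym b a) ⟩
    gaps b l z + gap a b            ≡⟨ +-comm _ (gap a b) ⟩
    gap a b + gaps b l z            ∎
    where open ≡-Reasoning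

  cgaps : List (Fin n) → ℕ
  cgaps []      = 0
  cgaps (x ∷ l) = gaps x l x

  cgaps-rotate : ∀ a l b l′ → cgaps (b ∷ l′ ++ a ∷ l) ≡ cgaps (a ∷ l ++ b ∷ l′)
  cgaps-rotate a l b l′ = begin
    gaps b (l′ ++ a ∷ l) b    ≡⟨ gaps-++ b l′ a l b ⟩
    gaps b l′ a + gaps a l b  ≡⟨ +-comm (gaps b l′ a) _ ⟩
    gaps a l b + gaps b l′ a  ≡⟨ gaps-++ a l b l′ a ⟨
    gaps a (l ++ b ∷ l′) a    ∎
    where open ≡-Reasoning

open Graph

-- Counting gaps lets an imperfect cyclic order be improved step by step. A single vertex fails, its
-- closing step being a loop; for two adjacent vertices the edge is traversed twice.
Hamiltonian : Graph n → Set
Hamiltonian {n} G = ∃ λ L → L ↭ allFin n × cgaps G L ≡ 0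

Closed : Graph n → Set
Closed {n} G = ∀ u v → u ≢ v → v ∉ nbr G u → deg G u + deg G v < n

module _ (G : Graph n) where

  -- The non-edge is stated from its later end, which comes first after the rotation in
  -- `rotate-gap`.
  find-gap : ∀ a l z → gaps G a l z ≢ 0 →
             (∃ λ l₀ → ∃ λ u → ∃ λ v → ∃ λ l₁ → a ∷ l ≡ l₀ ++ u ∷ v ∷ l₁ × u ∉ nbr G v)
             ⊎ (∃ λ l₀ → ∃ λ u → a ∷ l ≡ l₀ ++ [ u ] × u ∉ nbr G z)
  find-gap a []      z g≢0 = inj₂ ([] , a , refl , λ a∈ → g≢0 (gap-∈ G (nbr-sym G a∈)))
  find-gap a (b ∷ l) z g≢0 with a ∈? nbr G b
  ... | no a∉ = inj₁ ([] , a , b , l , refl , a∉)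
  ... | yes a∈ with find-gap b l z (λ eq → g≢0 (trans (cong (_+ gaps G b l z) (gap-∈ G (nbr-sym G a∈))) eq))
  ...   | inj₁ (l₀ , u , v , l₁ , eq , u∉) = inj₁ (a ∷ l₀ , u , v , l₁ , cong (a ∷_) eq , u∉)
  ...   | inj₂ (l₀ , u , eq , u∉)          = inj₂ (a ∷ l₀ , u , cong (a ∷_) eq , u∉)

  -- Cutting the cyclic order at a gap turns that gap into the closing step from `y` back to `x`.
  -- The count is preserved for every `H`, since it is needed both in a graph and in its
  -- augmentation.
  rotate-gap : ∀ L → cgaps G L ≢ 0 →
               (∃ λ a → L ≡ [ a ])
               ⊎ (∃ λ x → ∃ λ l → ∃ λ y → y ∉ nbr G x × x ∷ l ++ [ y ] ↭ L
                   × (∀ H → cgaps H (x ∷ l ++ [ y ]) ≡ cgaps H L))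
  rotate-gap []      g≢0 = ⊥-elim (g≢0 refl)
  rotate-gap (a ∷ l) g≢0 with find-gap a l a g≢0
  ... | inj₂ ([]     , u , refl , u∉) = inj₁ (a , refl)
  ... | inj₂ (_ ∷ l₀ , u , refl , u∉) = inj₂ (a , l₀ , u , u∉ , ↭-refl , λ _ → refl)
  ... | inj₁ ([]     , u , v , l₁ , refl , u∉) = inj₂ (v , l₁ , u , u∉ , ++-comm (v ∷ l₁) [ u ] , λ H → cgaps-rotate H u [] v l₁)
  ... | inj₁ (_ ∷ l₀ , u , v , l₁ , refl , u∉) =
    inj₂ (v , l₁ ++ a ∷ l₀ , u , u∉
      , ↭-trans (↭-reflexive (cong (v ∷_) assoc₁)) (↭-trans (++-comm (v ∷ l₁) (a ∷ l₀ ++ [ u ])) (↭-reflexive (cong (a ∷_) assoc₂)))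
      , λ H → trans (cong (cgaps H ∘ (v ∷_)) assoc₁) (trans (cgaps-rotate H a (l₀ ++ [ u ]) v l₁) (cong (cgaps H ∘ (a ∷_)) assoc₂)))
    where
    assoc₁ : (l₁ ++ a ∷ l₀) ++ [ u ] ≡ l₁ ++ a ∷ l₀ ++ [ u ]
    assoc₁ = ++-assoc l₁ (a ∷ l₀) [ u ]
    assoc₂ : (l₀ ++ [ u ]) ++ v ∷ l₁ ≡ l₀ ++ u ∷ v ∷ l₁
    assoc₂ = ++-assoc l₀ [ u ] (v ∷ l₁)

-- Ore's count: without such a consecutive pair, each step from `u` to `v` contributes at most 1
-- through `u` in `T` and `v` in `S` together, and the last vertex adds at most 1 through `T`.
crossing : ∀ (S T : Subset n) a l →
           (∃ λ p → ∃ λ u → ∃ λ v → ∃ λ q → a ∷ l ≡ p ++ u ∷ v ∷ q × u ∈ T × v ∈ S)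
           ⊎ ∑ (𝟙 S) l + ∑ (𝟙 T) (a ∷ l) ≤ suc (length l)
crossing S T a [] = inj₂ (≤-trans (≤-reflexive (+-identityʳ _)) (ι≤1 (Vec.lookup T a)))
crossing S T a (b ∷ l) with crossing S T b l
... | inj₁ (p , u , v , q , eq , u∈ , v∈) = inj₁ (a ∷ p , u , v , q , cong (a ∷_) eq , u∈ , v∈)
... | inj₂ bound with a ∈? T | b ∈? S
...   | yes a∈ | yes b∈ = inj₁ ([] , a , b , l , refl , a∈ , b∈)
...   | no  a∉ | _ = inj₂ (begin
  𝟙 S b + ∑ (𝟙 S) l + (𝟙 T a + ∑ (𝟙 T) (b ∷ l))  ≡⟨ cong (λ k → 𝟙 S b + ∑ (𝟙 S) l + (k + ∑ (𝟙 T) (b ∷ l))) (𝟙-∉ a∉) ⟩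
  𝟙 S b + ∑ (𝟙 S) l + ∑ (𝟙 T) (b ∷ l)            ≡⟨ +-assoc (𝟙 S b) _ _ ⟩
  𝟙 S b + (∑ (𝟙 S) l + ∑ (𝟙 T) (b ∷ l))          ≤⟨ +-mono-≤ (ι≤1 (Vec.lookup S b)) bound ⟩
  suc (suc (length l))                           ∎)
  where open ≤-Reasoning
...   | yes a∈ | no b∉ = inj₂ (begin
  𝟙 S b + ∑ (𝟙 S) l + (𝟙 T a + ∑ (𝟙 T) (b ∷ l))
    ≡⟨ cong₂ (λ k m → k + ∑ (𝟙 S) l + (m + ∑ (𝟙 T) (b ∷ l))) (𝟙-∉ b∉) (𝟙-∈ a∈) ⟩
  ∑ (𝟙 S) l + suc (∑ (𝟙 T) (b ∷ l))              ≡⟨ +-suc (∑ (𝟙 S) l) _ ⟩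
  suc (∑ (𝟙 S) l + ∑ (𝟙 T) (b ∷ l))              ≤⟨ s≤s bound ⟩
  suc (suc (length l))                           ∎)
  where open ≤-Reasoning

exchange-↭ : ∀ {A : Set} (x : A) p a b q y →
             x ∷ p ++ a ∷ y ∷ reverse q ++ [ b ] ↭ x ∷ (p ++ a ∷ b ∷ q) ++ [ y ]
exchange-↭ x p a b q y = prep x (↭-trans (++⁺ˡ p (prep a inner)) (↭-reflexive (sym (++-assoc p (a ∷ b ∷ q) [ y ]))))
  where
  inner : y ∷ reverse q ++ [ b ] ↭ (b ∷ q) ++ [ y ]
  inner = ↭-trans (prep y (↭-trans (↭-reflexive (sym (unfold-reverse b q))) (↭-reverse (b ∷ q)))) (++-comm [ y ] (b ∷ q))

-- The steps `a`-`b` and `y`-`x` give way to the edges `a`-`y` and `b`-`x`, with `q` traversed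
-- backwards. The gap at `y`-`x` is saved; a possible gap at `a`-`b` is dropped from the estimate.
exchange-gaps : ∀ (H : Graph n) x p a b q y → a ∈ nbr H y → b ∈ nbr H x →
                cgaps H (x ∷ p ++ a ∷ y ∷ reverse q ++ [ b ]) + gap H y x
                  ≤ cgaps H (x ∷ (p ++ a ∷ b ∷ q) ++ [ y ])
exchange-gaps H x p a b q y a∈ b∈ = begin
  cgaps H (x ∷ p ++ a ∷ y ∷ reverse q ++ [ b ]) + gap H y x  ≡⟨ cong (_+ gap H y x) new ⟩
  gaps H x p a + gaps H b q y + gap H y x                    ≤⟨ +-monoˡ-≤ (gap H y x) (+-monoʳ-≤ (gaps H x p a) (m≤n+m _ (gap H a b))) ⟩
  gaps H x p a + (gap H a b + gaps H b q y) + gap H y x      ≡⟨ cong (_+ gap H y x) (gaps-++ H x p a (b ∷ q) y) ⟨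
  gaps H x (p ++ a ∷ b ∷ q) y + gap H y x                    ≡⟨ gaps-++ H x (p ++ a ∷ b ∷ q) y [] x ⟨
  cgaps H (x ∷ (p ++ a ∷ b ∷ q) ++ [ y ])                    ∎
  where
  open ≤-Reasoning
  new : cgaps H (x ∷ p ++ a ∷ y ∷ reverse q ++ [ b ]) ≡ gaps H x p a + gaps H b q y
  new = trans (gaps-++ H x p a (y ∷ reverse q ++ [ b ]) x) (cong (gaps H x p a +_) (
    trans (cong₂ _+_ (gap-∈ H (nbr-sym H a∈)) (gaps-++ H y (reverse q) b [] x))
    (trans (cong₂ _+_ (gaps-reverse H b q y) (gap-∈ H (nbr-sym H b∈))) (+-identityʳ _))))

module _ (G : Graph n) where

  -- Applied with `v` equal to each end in turn: its neighbours avoid both ends and therefore lie in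
  -- `l`.
  deg≤∑ : ∀ {x l y} → x ∷ l ++ [ y ] ↭ allFin n → ∀ {v} → x ∉ nbr G v → y ∉ nbr G v →
          deg G v ≤ ∑ (𝟙 (nbr G v)) l
  deg≤∑ {x} {l} {y} perm {v} x∉ y∉ = begin
    deg G v                              ≡⟨ ∑-𝟙 (nbr G v) ⟨
    ∑ (𝟙 (nbr G v)) (allFin n)
      ≤⟨ ∑-support (𝟙 (nbr G v)) (allFin⁺ n) (x ∷ l ++ [ y ]) (λ _ _ → ∈-resp-↭ (↭-sym perm) (∈-allFin _)) ⟩
    ∑ (𝟙 (nbr G v)) (x ∷ l ++ [ y ])     ≡⟨ cong (_+ ∑ (𝟙 (nbr G v)) (l ++ [ y ])) (𝟙-∉ x∉) ⟩
    ∑ (𝟙 (nbr G v)) (l ++ [ y ])         ≡⟨ ∑-++ (𝟙 (nbr G v)) l [ y ] ⟩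
    ∑ (𝟙 (nbr G v)) l + (𝟙 (nbr G v) y + 0)  ≡⟨ cong (λ k → ∑ (𝟙 (nbr G v)) l + (k + 0)) (𝟙-∉ y∉) ⟩
    ∑ (𝟙 (nbr G v)) l + 0                ≡⟨ +-identityʳ _ ⟩
    ∑ (𝟙 (nbr G v)) l                    ∎
    where open ≤-Reasoning

  find-exchange : ∀ x l y → x ∷ l ++ [ y ] ↭ allFin n → y ∉ nbr G x → n ≤ deg G x + deg G y →
                  ∃ λ p → ∃ λ a → ∃ λ b → ∃ λ q → l ≡ p ++ a ∷ b ∷ q × a ∈ nbr G y × b ∈ nbr G x
  find-exchange x l y perm y∉ n≤ = go l len (≤-trans n≤ (+-mono-≤ (deg≤∑ perm (nbr-irr G) y∉) (deg≤∑ perm (y∉ ∘ nbr-sym G) (nbr-irr G))))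
    where
    len : n ≡ suc (suc (length l))
    len = trans (sym (length-tabulate id)) (trans (sym (↭-length perm))
            (cong suc (trans (length-++ l) (+-comm (length l) 1))))
    go : ∀ l → n ≡ suc (suc (length l)) → n ≤ ∑ (𝟙 (nbr G x)) l + ∑ (𝟙 (nbr G y)) l →
         ∃ λ p → ∃ λ a → ∃ λ b → ∃ λ q → l ≡ p ++ a ∷ b ∷ q × a ∈ nbr G y × b ∈ nbr G x
    go [] eq le = ⊥-elim (<⇒≱ (s≤s z≤n) (≤-trans (≤-reflexive (sym eq)) le))
    go (c ∷ l) eq le with crossing (nbr G x) (nbr G y) c l
    ... | inj₁ found = found
    ... | inj₂ bound = ⊥-elim (<⇒≱ (≤-refl {suc (suc (suc (length l)))}) (begin
      suc (suc (suc (length l)))  ≡⟨ eq ⟨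
      n                           ≤⟨ le ⟩
      -- The first inner vertex has no predecessor in the list, so its indicator is bounded
      -- separately; the total still stays one below `n`.
      𝟙 (nbr G x) c + ∑ (𝟙 (nbr G x)) l + ∑ (𝟙 (nbr G y)) (c ∷ l)    ≡⟨ +-assoc (𝟙 (nbr G x) c) _ _ ⟩
      𝟙 (nbr G x) c + (∑ (𝟙 (nbr G x)) l + ∑ (𝟙 (nbr G y)) (c ∷ l))  ≤⟨ +-mono-≤ (ι≤1 (Vec.lookup (nbr G x) c)) bound ⟩
      suc (suc (length l))        ∎))
      where open ≤-Reasoning

  Joined : Fin n → Fin n → Set
  Joined u v = u ≢ v × (v ∈ nbr G u ⊎ n ≤ deg G u + deg G v)

  joined? : ∀ u → Decidable (Joined u)
  joined? u v = ¬? (u Fin.≟ v) ×-dec (v ∈? nbr G u ⊎-dec (n ≤? deg G u + deg G v))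

  -- All pairs of large degree sum are joined at once, so a Hamiltonian cycle of this graph may have
  -- many gaps in `G`.
  augment : Graph n
  augment .nbr u = ⟦ joined? u ⟧
  augment .nbr-sym {u} {v} v∈ with ∈⟦⟧⁻ (joined? u) v∈
  ... | u≢v , inj₁ v∈nbr = ∈⟦⟧⁺ (joined? v) (u≢v ∘ sym , inj₁ (nbr-sym G v∈nbr))
  ... | u≢v , inj₂ n≤    = ∈⟦⟧⁺ (joined? v) (u≢v ∘ sym , inj₂ (≤-trans n≤ (≤-reflexive (+-comm (deg G u) _))))
  augment .nbr-irr {u} u∈ = proj₁ (∈⟦⟧⁻ (joined? u) u∈) refl

  ⊆-augment : ∀ u → nbr G u ⊆ nbr augment u
  ⊆-augment u {v} v∈ = ∈⟦⟧⁺ (joined? u) ((λ { refl → nbr-irr G v∈ }) , inj₁ v∈)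

  -- Ore's exchange replaces a gap between x and y by edges of G, so the number of gaps drops.
  augment-hamiltonian : Hamiltonian augment → Hamiltonian G
  augment-hamiltonian (L₀ , perm₀ , eq₀) = go (cgaps G L₀) L₀ perm₀ eq₀ ≤-refl
    where
    go : ∀ k L → L ↭ allFin n → cgaps augment L ≡ 0 → cgaps G L ≤ k → Hamiltonian G
    go zero    L perm eq le = L , perm , n≤0⇒n≡0 le
    go (suc k) L perm eq le with cgaps G L ≟ 0
    ... | yes g≡0 = L , perm , g≡0
    ... | no  g≢0 with rotate-gap G L g≢0
    ...   | inj₁ (a , refl) = ⊥-elim (nbr-irr augment (gap≡0⇒∈ augment eq))
    ...   | inj₂ (x , l , y , y∉ , perm′ , same)
      with ∈⟦⟧⁻ (joined? y) (gap≡0⇒∈ augment (m+n≡0⇒n≡0 (gaps augment x l y)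
             (trans (sym (gaps-++ augment x l y [] x)) (trans (same augment) eq))))
    ...     | _ , inj₁ x∈ = ⊥-elim (y∉ (nbr-sym G x∈))
    ...     | _ , inj₂ n≤ with find-exchange x l y (↭-trans perm′ perm) y∉ (≤-trans n≤ (≤-reflexive (+-comm (deg G y) _)))
    ...       | p , a , b , q , refl , a∈ , b∈ =
      go k (x ∷ p ++ a ∷ y ∷ reverse q ++ [ b ]) (↭-trans (exchange-↭ x p a b q y) (↭-trans perm′ perm))
        -- The exchange edges belong to `G` and hence to `augment`, so the new order still has no
        -- gap there.
        (n≤0⇒n≡0 (≤-trans (m≤m+n _ _)
          (≤-trans (exchange-gaps augment x p a b q y (⊆-augment y a∈) (⊆-augment x b∈))
                   (≤-reflexive (trans (same augment) eq)))))
        (≤-pred (begin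
          suc (cgaps G L′)          ≡⟨ +-comm 1 _ ⟩
          cgaps G L′ + 1            ≡⟨ cong (cgaps G L′ +_) (gap-∉ G (y∉ ∘ nbr-sym G)) ⟨
          cgaps G L′ + gap G y x    ≤⟨ exchange-gaps G x p a b q y a∈ b∈ ⟩
          cgaps G (x ∷ (p ++ a ∷ b ∷ q) ++ [ y ])  ≡⟨ same G ⟩
          cgaps G L                 ≤⟨ le ⟩
          suc k                     ∎))
      where
      open ≤-Reasoning
      L′ = x ∷ p ++ a ∷ y ∷ reverse q ++ [ b ]

∑deg : Graph n → ℕ
∑deg {n} G = ∑ (deg G) (allFin n)

∑deg≤ : ∀ (G : Graph n) → ∑deg G ≤ n * n
∑deg≤ {n} G = ≤-trans (∑-≤-* (deg G) n (allFin n) (λ {u} _ → ∣p∣≤n (nbr G u))) (≤-reflexive (cong (_* n) (length-tabulate (id {A = Fin n}))))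

HasClosure : Graph n → Set
HasClosure G = ∃ λ G* → (∀ u → nbr G u ⊆ nbr G* u) × Closed G* × (Hamiltonian G* → Hamiltonian G)

-- Augmenting while some pair violates `Closed` strictly raises the degree sum, which never exceeds
-- `n * n`; this bounds the recursion.
closure : ∀ (G : Graph n) → HasClosure G
closure {n} G₀ = go (n * n) G₀ (m≤m+n (n * n) _)
  where
  go : ∀ k G → n * n ≤ k + ∑deg G → HasClosure G
  go k G le with Fin.any? (λ u → Fin.any? (λ v → ¬? (u Fin.≟ v) ×-dec (¬? (v ∈? nbr G u) ×-dec (n ≤? deg G u + deg G v))))
  ... | no  none = G , (λ _ → id) , (λ u v u≢v v∉ → ≰⇒> λ n≤ → none (u , v , u≢v , v∉ , n≤)) , id
  ... | yes (u , v , u≢v , v∉ , n≤) = step k le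
    where
    larger : ∑deg G < ∑deg (augment G)
    larger = ∑-mono-< (λ w → p⊆q⇒∣p∣≤∣q∣ (⊆-augment G w)) (∈-allFin u)
               (p⊂q⇒∣p∣<∣q∣ (⊆-augment G u , v , ∈⟦⟧⁺ (joined? G u) (u≢v , inj₂ n≤) , v∉))
    step : ∀ k → n * n ≤ k + ∑deg G → HasClosure G
    step zero    le = ⊥-elim (<⇒≱ larger (≤-trans (∑deg≤ (augment G)) le))
    step (suc k) le with go k (augment G) (≤-trans le (≤-trans (≤-reflexive (sym (+-suc k _))) (+-monoʳ-≤ k larger)))
    ... | G* , sub , closed , ham = G* , (λ w → sub w ∘ ⊆-augment G w) , closed , augment-hamiltonian G ∘ ham

Complete : Graph n → Set
Complete G = ∀ u v → u ≢ v → v ∈ nbr G u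

complete-gaps : ∀ (G : Graph n) → Complete G → ∀ b l z → Unique (b ∷ l) → All (z ≢_) (b ∷ l) → gaps G b l z ≡ 0
complete-gaps G comp b []      z uq (z≢b ∷ []) = gap-∈ G (comp b z (z≢b ∘ sym))
complete-gaps G comp b (c ∷ l) z ((b≢c ∷ _) ∷ uq) (_ ∷ z≢) =
  cong₂ _+_ (gap-∈ G (comp b c b≢c)) (complete-gaps G comp c l z uq z≢)

complete⇒hamiltonian : ∀ (G : Graph (suc (suc n))) → Complete G → Hamiltonian G
complete⇒hamiltonian {n} G comp with allFin⁺ (suc (suc n))
... | x≢ ∷ uq = allFin _ , ↭-refl , cong₂ _+_ (gap-∈ G (comp zero (suc zero) λ ())) (complete-gaps G comp _ _ zero uq x≢)

disjoint⇒∣p∣+∣q∣≤n : ∀ (p q : Subset n) → (∀ {x} → x ∈ p → x ∉ q) → ∣ p ∣ + ∣ q ∣ ≤ n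
disjoint⇒∣p∣+∣q∣≤n {n} p q disj = begin
  ∣ p ∣ + ∣ q ∣        ≤⟨ +-monoˡ-≤ ∣ q ∣ (p⊆q⇒∣p∣≤∣q∣ (x∉p⇒x∈∁p ∘ disj)) ⟩
  ∣ ∁ q ∣ + ∣ q ∣      ≡⟨ cong (_+ ∣ q ∣) (∣∁p∣≡n∸∣p∣ q) ⟩
  n ∸ ∣ q ∣ + ∣ q ∣    ≡⟨ m∸n+n≡m (∣p∣≤n q) ⟩
  n                    ∎
  where open ≤-Reasoning

x∉q⇒∣q∣<∣⁅x⁆∪q∣ : ∀ {x} (q : Subset n) → x ∉ q → ∣ q ∣ < ∣ ⁅ x ⁆ ∪ q ∣
x∉q⇒∣q∣<∣⁅x⁆∪q∣ {x = x} q x∉q = p⊂q⇒∣p∣<∣q∣ (q⊆p∪q ⁅ x ⁆ q , x , x∈p∪q⁺ (inj₁ (x∈⁅x⁆ x)) , x∉q)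

⊆∧∣∣≥⇒⊇ : ∀ {p q : Subset n} → p ⊆ q → ∣ q ∣ ≤ ∣ p ∣ → q ⊆ p
⊆∧∣∣≥⇒⊇ {p = p} p⊆q q≤p {x} x∈q with x ∈? p
... | yes x∈p = x∈p
... | no  x∉p = ⊥-elim (<⇒≱ (p⊂q⇒∣p∣<∣q∣ (p⊆q , x , x∈q , x∉p)) q≤p)

-- Non-edges of non-Hamiltonian closed graphs

-- In a closed graph, a vertex of minimum degree and its non-neighbours.
record Star (G : Graph n) : Set where
  field
    centre    : Fin n
    leaves    : Subset n
    leaf-≢    : ∀ {x} → x ∈ leaves → centre ≢ x
    leaf-∉    : ∀ {x} → x ∈ leaves → x ∉ nbr G centre
    nonempty  : Nonempty leaves
    leaf-deg  : ∀ {x} → x ∈ leaves → deg G x ≤ ∣ leaves ∣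
    large     : n ≤ suc (∣ leaves ∣ + ∣ leaves ∣)

  centre∉leaves : centre ∉ leaves
  centre∉leaves v∈ = leaf-≢ v∈ refl

open Star

-- For `v` of minimum degree, n ≤ 1 + |L| + deg v. A non-edge `u`, `w` gives 2 deg v ≤ deg u + deg w
-- < n, hence deg v ≤ |L| and n ≤ 1 + 2|L|. A leaf `x` satisfies deg v + deg x < n, hence deg x ≤
-- |L|.
closed⇒complete⊎star : ∀ (G : Graph n) → Closed G → Complete G ⊎ Star G
closed⇒complete⊎star {n} G closed with Fin.any? (λ u → Fin.any? (λ w → ¬? (u Fin.≟ w) ×-dec ¬? (w ∈? nbr G u)))
... | no  none = inj₁ complete
  where
  complete : Complete G
  complete u w u≢w with w ∈? nbr G u
  ... | yes w∈ = w∈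
  ... | no  w∉ = ⊥-elim (none (u , w , u≢w , w∉))
... | yes (u , w , u≢w , w∉) = inj₂ star
  where
  open ≤-Reasoning

  v : Fin n
  v = argmin (deg G) u (allFin n)

  v-min : ∀ x → deg G v ≤ deg G x
  v-min x = All.lookup (f[argmin]≤f[xs] u (allFin n)) (∈-allFin x)

  leaf? : Decidable (λ x → v ≢ x × x ∉ nbr G v)
  leaf? x = ¬? (v Fin.≟ x) ×-dec ¬? (x ∈? nbr G v)

  L : Subset n
  L = ⟦ leaf? ⟧

  cover : ∀ {x} → x ∈ Subset.⊤ → x ∈ L ∪ (⁅ v ⁆ ∪ nbr G v)
  cover {x} _ with v Fin.≟ x | x ∈? nbr G v
  ... | yes refl | _      = x∈p∪q⁺ (inj₂ (x∈p∪q⁺ (inj₁ (x∈⁅x⁆ v))))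
  ... | no v≢x   | yes x∈ = x∈p∪q⁺ (inj₂ (x∈p∪q⁺ (inj₂ x∈)))
  ... | no v≢x   | no x∉  = x∈p∪q⁺ (inj₁ (∈⟦⟧⁺ leaf? (v≢x , x∉)))

  n≤ : n ≤ suc (∣ L ∣ + deg G v)
  n≤ = begin
    n                              ≡⟨ ∣⊤∣≡n n ⟨
    ∣ Subset.⊤ {n} ∣               ≤⟨ p⊆q⇒∣p∣≤∣q∣ cover ⟩
    ∣ L ∪ (⁅ v ⁆ ∪ nbr G v) ∣      ≤⟨ ∣∪∣≤ L _ ⟩
    ∣ L ∣ + ∣ ⁅ v ⁆ ∪ nbr G v ∣    ≤⟨ +-monoʳ-≤ ∣ L ∣ (∣⁅x⁆∪∣≤ v (nbr G v)) ⟩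
    ∣ L ∣ + suc (deg G v)          ≡⟨ +-suc ∣ L ∣ _ ⟩
    suc (∣ L ∣ + deg G v)          ∎

  degv≤∣L∣ : deg G v ≤ ∣ L ∣
  degv≤∣L∣ = +-cancelʳ-≤ (deg G v) _ _ (≤-pred (begin
    suc (deg G v + deg G v)  ≤⟨ s≤s (+-mono-≤ (v-min u) (v-min w)) ⟩
    suc (deg G u + deg G w)  ≤⟨ closed u w u≢w w∉ ⟩
    n                        ≤⟨ n≤ ⟩
    suc (∣ L ∣ + deg G v)    ∎))

  L-large : n ≤ suc (∣ L ∣ + ∣ L ∣)
  L-large = ≤-trans n≤ (s≤s (+-monoʳ-≤ ∣ L ∣ degv≤∣L∣))

  L-nonempty : Nonempty L
  L-nonempty with nonempty? L
  ... | yes ne = ne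
  ... | no  em = ⊥-elim (trivial u w u≢w (subst (λ k → n ≤ suc (k + k)) ∣L∣≡0 L-large))
    where
    ∣L∣≡0 : ∣ L ∣ ≡ 0
    ∣L∣≡0 = trans (cong ∣_∣ (Empty-unique em)) (∣⊥∣≡0 n)
    trivial : ∀ {m} (a b : Fin m) → a ≢ b → ¬ m ≤ 1
    trivial zero zero a≢b _ = a≢b refl
    trivial zero    (suc ()) _ (s≤s z≤n)
    trivial (suc ()) _       _ (s≤s z≤n)

  star : Star G
  star .centre = v
  star .leaves = L
  star .leaf-≢ x∈ = proj₁ (∈⟦⟧⁻ leaf? x∈)
  star .leaf-∉ x∈ = proj₂ (∈⟦⟧⁻ leaf? x∈)
  star .nonempty  = L-nonempty
  star .leaf-deg {x} x∈ = +-cancelˡ-≤ (deg G v) _ _ (≤-pred (begin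
    suc (deg G v + deg G x)  ≤⟨ closed v x (proj₁ (∈⟦⟧⁻ leaf? x∈)) (proj₂ (∈⟦⟧⁻ leaf? x∈)) ⟩
    n                        ≤⟨ n≤ ⟩
    suc (∣ L ∣ + deg G v)    ≡⟨ cong suc (+-comm ∣ L ∣ _) ⟩
    suc (deg G v + ∣ L ∣)    ∎))
  star .large = L-large

-- Small vertex sets that contain a non-edge of every graph.

record Covers (G : Graph n) (W : Subset n) : Set where
  constructor covers
  field
    fst snd   : Fin n
    fst∈      : fst ∈ W
    snd∈      : snd ∈ W
    fst≢snd   : fst ≢ snd
    snd∉nbr   : snd ∉ nbr G fst

Covers-⊆ : ∀ {G : Graph n} {W W′} → W ⊆ W′ → Covers G W → Covers G W′
Covers-⊆ W⊆ (covers a b a∈ b∈ a≢b b∉) = covers a b (W⊆ a∈) (W⊆ b∈) a≢b b∉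

module _ {I : Set} (G : I → Graph n) (star : ∀ i → Star (G i)) where

  private
    v : I → Fin n
    v i = centre (star i)

    L : I → Subset n
    L i = leaves (star i)

  Sorted : List I → Set
  Sorted = Linked (λ i j → ∣ L i ∣ ≤ ∣ L j ∣)

  -- The prescribed vertex `x` is where the non-edge of the next colour can be attached, so that
  -- prepending a colour need cost only one new vertex.
  Transversal : List I → Fin n → Set
  Transversal J x = ∃ λ W → x ∈ W × ∣ W ∣ ≤ suc (length J) × All (λ j → Covers (G j) W) J

  extend : ∀ {i J x} y → Transversal J y → (∀ {W} → y ∈ W → ∃ λ s → x ∈ ⁅ s ⁆ ∪ W × Covers (G i) (⁅ s ⁆ ∪ W)) →
           Transversal (i ∷ J) x
  extend y (W , y∈ , size , cov) ext with ext y∈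
  ... | s , x∈ , covᵢ = ⁅ s ⁆ ∪ W , x∈ , ≤-trans (∣⁅x⁆∪∣≤ s W) (s≤s size) , covᵢ ∷ All.map (Covers-⊆ (q⊆p∪q ⁅ s ⁆ W)) cov

  singleton : ∀ x → Transversal [] x
  singleton x = ⁅ x ⁆ , x∈⁅x⁆ x , ≤-reflexive (∣⁅x⁆∣≡1 x) , []

  -- When every leaf of j is a neighbour of x in G i, the two non-edges
  -- for i and j are found together, on x and two more vertices.
  module _ (i j : I) {x : Fin n} (x∈Lᵢ : x ∈ L i) (i≤j : ∣ L i ∣ ≤ ∣ L j ∣)
           (Lⱼ⊆ : L j ⊆ nbr (G i) x) where

    private
      -- The degree bound for leaves gives deg x ≤ |L i| ≤ |L j|, so the inclusion `Lⱼ⊆` is an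
      -- equality.
      ∉Lⱼ⇒∉nbr : ∀ {y} → y ∉ L j → y ∉ nbr (G i) x
      ∉Lⱼ⇒∉nbr y∉ y∈ = y∉ (⊆∧∣∣≥⇒⊇ Lⱼ⊆ (≤-trans (leaf-deg (star i) x∈Lᵢ) i≤j) y∈)

      x∉Lⱼ : x ∉ L j
      x∉Lⱼ x∈ = nbr-irr (G i) (Lⱼ⊆ x∈)

      v∉ : v j ∉ nbr (G i) x
      v∉ = ∉Lⱼ⇒∉nbr (centre∉leaves (star j))

      l : Fin n
      l = proj₁ (nonempty (star j))

      l∈ : l ∈ L j
      l∈ = proj₂ (nonempty (star j))

    -- The positions of `z`, a vertex already in `W`, for which two new vertices suffice. If `x` is
    -- not `v j`, the non-edges will be `x`-`v j` for `i` and one from `v j` to a leaf for `j`, and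
    -- `z` has to be one of these vertices. If `x` is `v j`, every `z` will do.
    Fit : Fin n → Set
    Fit z = x ≡ v j ⊎ (x ≢ v j × z ∈ ⁅ x ⁆ ∪ (⁅ v j ⁆ ∪ L j))

    join : ∀ {z W} → Fit z → z ∈ W →
           ∃ λ s → ∃ λ t → x ∈ ⁅ s ⁆ ∪ (⁅ t ⁆ ∪ W) × Covers (G i) (⁅ s ⁆ ∪ (⁅ t ⁆ ∪ W)) × Covers (G j) (⁅ s ⁆ ∪ (⁅ t ⁆ ∪ W))
    join {z} {W} fit z∈ = by-cases fit (z Fin.≟ x) (z ∈? L j)
      where
      one : ∀ {s t} → s ∈ ⁅ s ⁆ ∪ (⁅ t ⁆ ∪ W)
      one {s} = x∈p∪q⁺ (inj₁ (x∈⁅x⁆ s))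

      two : ∀ {s t} → t ∈ ⁅ s ⁆ ∪ (⁅ t ⁆ ∪ W)
      two {s} {t} = x∈p∪q⁺ (inj₂ (x∈p∪q⁺ (inj₁ (x∈⁅x⁆ t))))

      three : ∀ {s t} → z ∈ ⁅ s ⁆ ∪ (⁅ t ⁆ ∪ W)
      three = x∈p∪q⁺ (inj₂ (x∈p∪q⁺ (inj₂ z∈)))

      centreᵢ : ∀ {W} → v i ∈ W → x ∈ W → Covers (G i) W
      centreᵢ v∈ x∈ = covers (v i) x v∈ x∈ (leaf-≢ (star i) x∈Lᵢ) (leaf-∉ (star i) x∈Lᵢ)

      centreⱼ : ∀ {W y} → v j ∈ W → y ∈ W → y ∈ L j → Covers (G j) W
      centreⱼ {y = y} v∈ y∈W y∈ = covers (v j) y v∈ y∈W (leaf-≢ (star j) y∈) (leaf-∉ (star j) y∈)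

      by-cases : Fit z → Dec (z ≡ x) → Dec (z ∈ L j) →
                 ∃ λ s → ∃ λ t → x ∈ ⁅ s ⁆ ∪ (⁅ t ⁆ ∪ W) × Covers (G i) (⁅ s ⁆ ∪ (⁅ t ⁆ ∪ W)) × Covers (G j) (⁅ s ⁆ ∪ (⁅ t ⁆ ∪ W))
      -- With `x` equal to `v j`: a leaf `z` settles `j` and leaves a vertex for `v i`; if `z` is
      -- `x`, both new vertices are free for `v i` and `l`; any other `z` is a non-neighbour of `x`
      -- in `G i` and settles `i`, leaving `l` for `j`.
      by-cases (inj₁ refl) _         (yes z∈L) = x , v i , one , centreᵢ two one , centreⱼ one three z∈L
      by-cases (inj₁ refl) (yes refl) (no _)   = v i , l , three , centreᵢ one three , centreⱼ three two l∈
      by-cases (inj₁ refl) (no z≢x)  (no z∉L)  = x , l , one , covers x z one three (z≢x ∘ sym) (∉Lⱼ⇒∉nbr z∉L) , centreⱼ one two l∈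
      by-cases (inj₂ (x≢v , _)) _ (yes z∈L) = x , v j , one , covers x (v j) one two x≢v v∉ , centreⱼ two three z∈L
      by-cases (inj₂ (x≢v , z∈′)) _ (no z∉L) with x∈p∪q⁻ ⁅ x ⁆ _ z∈′
      ... | inj₁ z∈x with x∈⁅y⁆⇒x≡y x z∈x
      ...   | refl = v j , l , three , covers x (v j) three one x≢v v∉ , centreⱼ one two l∈
      by-cases (inj₂ (x≢v , z∈′)) _ (no z∉L) | inj₂ z∈vL with x∈p∪q⁻ ⁅ v j ⁆ _ z∈vL
      ...   | inj₂ z∈L = ⊥-elim (z∉L z∈L)
      ...   | inj₁ z∈v with x∈⁅y⁆⇒x≡y (v j) z∈v
      ...     | refl = x , l , one , covers x (v j) one three x≢v v∉ , centreⱼ three two l∈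

    -- If `x` is not `v j`, then `x`, `v j` and `L j` form a set of at least |L j| + 2 elements.
    -- Were it disjoint from `L k`, then |L k| + |L j| + 2 ≤ n ≤ 2|L j| + 1, contrary to |L j| ≤ |L
    -- k|.
    fit-leaf : ∀ k → ∣ L j ∣ ≤ ∣ L k ∣ → ∃ λ z → z ∈ L k × Fit z
    fit-leaf k j≤k with x Fin.≟ v j
    ... | yes x≡v = proj₁ (nonempty (star k)) , proj₂ (nonempty (star k)) , inj₁ x≡v
    ... | no  x≢v with Fin.any? (λ z → z ∈? L k ×-dec (z ∈? ⁅ x ⁆ ∪ (⁅ v j ⁆ ∪ L j)))
    ...   | yes (z , z∈L , z∈) = z , z∈L , inj₂ (x≢v , z∈)
    ...   | no  none = ⊥-elim (<-irrefl refl (begin-strict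
      n                                                   ≤⟨ large (star j) ⟩
      suc (∣ L j ∣ + ∣ L j ∣)                             ≤⟨ s≤s (+-monoˡ-≤ ∣ L j ∣ j≤k) ⟩
      suc (∣ L k ∣ + ∣ L j ∣)                             ≡⟨ +-suc ∣ L k ∣ _ ⟨
      ∣ L k ∣ + suc ∣ L j ∣                               ≤⟨ +-monoʳ-≤ ∣ L k ∣ (x∉q⇒∣q∣<∣⁅x⁆∪q∣ (L j) (centre∉leaves (star j))) ⟩
      ∣ L k ∣ + ∣ ⁅ v j ⁆ ∪ L j ∣                         <⟨ +-monoʳ-< ∣ L k ∣ (x∉q⇒∣q∣<∣⁅x⁆∪q∣ (⁅ v j ⁆ ∪ L j) x∉) ⟩
      ∣ L k ∣ + ∣ ⁅ x ⁆ ∪ (⁅ v j ⁆ ∪ L j) ∣               ≤⟨ disjoint⇒∣p∣+∣q∣≤n (L k) _ (λ z∈L z∈ → none (_ , z∈L , z∈)) ⟩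
      n                                                   ∎))
      where
      open ≤-Reasoning
      x∉ : x ∉ ⁅ v j ⁆ ∪ L j
      x∉ x∈ with x∈p∪q⁻ ⁅ v j ⁆ _ x∈
      ... | inj₁ x∈v = x≢v (x∈⁅y⁆⇒x≡y (v j) x∈v)
      ... | inj₂ x∈L = x∉Lⱼ x∈L

    fit-first : Fit l
    fit-first with x Fin.≟ v j
    ... | yes x≡v = inj₁ x≡v
    ... | no  x≢v = inj₂ (x≢v , x∈p∪q⁺ (inj₂ (x∈p∪q⁺ (inj₂ l∈))))

    join-transversal : ∀ {z J} → Fit z → Transversal J z → Transversal (i ∷ j ∷ J) x
    join-transversal fit (W , z∈ , size , cov) with join fit z∈
    ... | s , t , x∈ , covᵢ , covⱼ =
      ⁅ s ⁆ ∪ (⁅ t ⁆ ∪ W) , x∈ , ≤-trans (∣⁅x⁆∪∣≤ s _) (s≤s (≤-trans (∣⁅x⁆∪∣≤ t W) (s≤s size))) ,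
      covᵢ ∷ covⱼ ∷ All.map (Covers-⊆ (q⊆p∪q ⁅ s ⁆ _ ∘ q⊆p∪q ⁅ t ⁆ W)) cov

  -- A leaf `y` of `j` that is not adjacent to `x` in `G i` continues the path. If there is none,
  -- `i` and `j` are served together and the recursion resumes at the third colour `k`, entered at a
  -- fitting leaf.
  transversal : ∀ i J → Sorted (i ∷ J) → ∀ {x} → x ∈ L i → Transversal (i ∷ J) x
  transversal i [] _ {x} x∈ = extend x (singleton x) λ x∈W →
    v i , x∈p∪q⁺ (inj₂ x∈W) ,
    covers (v i) x (x∈p∪q⁺ (inj₁ (x∈⁅x⁆ _))) (x∈p∪q⁺ (inj₂ x∈W)) (leaf-≢ (star i) x∈) (leaf-∉ (star i) x∈)
  transversal i (j ∷ J) (i≤j ∷ sorted) {x} x∈ with Fin.any? (λ y → y ∈? L j ×-dec ¬? (y ∈? nbr (G i) x))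
  ... | yes (y , y∈ , y∉) = extend y (transversal j J sorted y∈) next
    where
    next : ∀ {W} → y ∈ W → ∃ λ s → x ∈ ⁅ s ⁆ ∪ W × Covers (G i) (⁅ s ⁆ ∪ W)
    next y∈W with x Fin.≟ y
    -- If the path stays at `x`, the non-edge for `i` joins the centre `v i` to its leaf `x`.
    ... | yes refl = v i , x∈p∪q⁺ (inj₂ y∈W) ,
      covers (v i) x (x∈p∪q⁺ (inj₁ (x∈⁅x⁆ _))) (x∈p∪q⁺ (inj₂ y∈W)) (leaf-≢ (star i) x∈) (leaf-∉ (star i) x∈)
    ... | no x≢y = x , x∈p∪q⁺ (inj₁ (x∈⁅x⁆ _)) ,
      covers x y (x∈p∪q⁺ (inj₁ (x∈⁅x⁆ _))) (x∈p∪q⁺ (inj₂ y∈W)) x≢y y∉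
  ... | no none = tie J sorted
    where
    Lⱼ⊆ : L j ⊆ nbr (G i) x
    Lⱼ⊆ {y} y∈ with y ∈? nbr (G i) x
    ... | yes y∈N = y∈N
    ... | no  y∉N = ⊥-elim (none (y , y∈ , y∉N))

    tie : ∀ J → Sorted (j ∷ J) → Transversal (i ∷ j ∷ J) x
    -- With no colour left, a single leaf of `j` is the initial set: three vertices for two colours.
    tie []      _              = join-transversal i j x∈ i≤j Lⱼ⊆ (fit-first i j x∈ i≤j Lⱼ⊆) (singleton _)
    tie (k ∷ J) (j≤k ∷ sorted) with fit-leaf i j x∈ i≤j Lⱼ⊆ k j≤k
    ... | z , z∈ , fit = join-transversal i j x∈ i≤j Lⱼ⊆ fit (transversal k J sorted z∈)

∃⊎∀ : ∀ {c} {P Q : Fin c → Set} → (∀ i → P i ⊎ Q i) → ∃ P ⊎ (∀ i → Q i)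
∃⊎∀ {zero}  f = inj₂ λ ()
∃⊎∀ {suc c} f with f zero | ∃⊎∀ (f ∘ suc)
... | inj₁ p | _            = inj₁ (zero , p)
... | inj₂ q | inj₁ (i , p) = inj₁ (suc i , p)
... | inj₂ q | inj₂ qs      = inj₂ λ { zero → q ; (suc i) → qs i }

stars⇒covers : ∀ {c} (G : Fin c → Graph n) → (∀ i → Star (G i)) →
               ∃ λ W → ∣ W ∣ ≤ suc c × (∀ i → Covers (G i) W)
stars⇒covers {n} {c} G star = result (sort order (allFin c)) (sort-↗ order (allFin c)) (sort-↭ order (allFin c))
  where
  order = On.decTotalOrder ≤-decTotalOrder (λ i → ∣ leaves (star i) ∣)

  result : ∀ J → Sorted G star J → J ↭ allFin c → ∃ λ W → ∣ W ∣ ≤ suc c × (∀ i → Covers (G i) W)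
  result [] _ perm = Subset.⊥ , ≤-trans (≤-reflexive (∣⊥∣≡0 n)) z≤n , λ i → case ∈-resp-↭ (↭-sym perm) (∈-allFin i) of λ ()
  result (i ∷ J) sorted perm with transversal G star i J sorted (proj₂ (nonempty (star i)))
  ... | W , _ , size , cov =
    W , ≤-trans size (≤-reflexive (cong suc (trans (↭-length perm) (length-tabulate (id {A = Fin c}))))) ,
    λ j → All.lookup cov (∈-resp-↭ (↭-sym perm) (∈-allFin j))

-- A non-edge of a closure is a non-edge of the original graph, so a set covering all closures
-- covers all the graphs. Two vertices are present so that complete graphs are Hamiltonian.
hamiltonian⊎covers : ∀ {c} (G : Fin c → Graph (suc (suc n))) →
                     (∃ λ i → Hamiltonian (G i)) ⊎ (∃ λ W → ∣ W ∣ ≤ suc c × (∀ i → Covers (G i) W))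
hamiltonian⊎covers {n} {c} G = Sum.map₂ shrink (∃⊎∀ dichotomy)
  where
  Reduct : Fin c → Set
  Reduct i = ∃ λ H → (∀ u → nbr (G i) u ⊆ nbr H u) × Star H

  dichotomy : ∀ i → Hamiltonian (G i) ⊎ Reduct i
  dichotomy i =
    let H , sub , closed , ham = closure (G i)
    in Sum.map (ham ∘ complete⇒hamiltonian H) (λ star → H , sub , star) (closed⇒complete⊎star H closed)

  shrink : (∀ i → Reduct i) → ∃ λ W → ∣ W ∣ ≤ suc c × (∀ i → Covers (G i) W)
  shrink stars =
    let W , size , cov = stars⇒covers (proj₁ ∘ stars) (proj₂ ∘ proj₂ ∘ stars)
    in W , size , λ i →
      let covers a b a∈ b∈ a≢b b∉ = cov i in covers a b a∈ b∈ a≢b (b∉ ∘ proj₁ (proj₂ (stars i)) a)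

-- Hall's theorem in degree form

-- The lower bound for rows equals the upper bound for columns, so Hall's condition follows by
-- double counting; the form `suc d` makes the common bound positive.
module _ {B : Set} (_≟ᴮ_ : DecidableEquality B) {m : ℕ} (R : Fin m → B → Bool)
         (bs : List B) (bs-unique : Unique bs) (d : ℕ)
         (row : ∀ a → suc d ≤ ∑ (ι ∘ R a) bs)
         (column : ∀ b → ∑ (λ a → ι (R a b)) (allFin m) ≤ suc d) where

  open DecMembership _≟ᴮ_ using () renaming (_∈?_ to _∈ᴮ?_)
  open DecMembership (Fin._≟_ {m}) using () renaming (_∈?_ to _∈ᶠ?_)

  -- A partial matching is a total function of which only the values on `D` matter; a predicate as
  -- domain makes it easy to leave out one vertex.
  record Matching (D : Fin m → Set) (f : Fin m → B) : Set where
    field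
      related   : ∀ {a} → D a → R a (f a) ≡ true
      injective : ∀ {a a′} → D a → D a′ → f a ≡ f a′ → a ≡ a′

  open Matching

  private
    ι-true : ∀ {b} → 0 < ι b → b ≡ true
    ι-true {true} _ = refl

  -- Otherwise, counting R between a₀ ∷ S and map f S by rows and by columns is contradictory.
  unsaturated : ∀ (f : Fin m → B) {a₀ S} → Unique (a₀ ∷ S) →
                ∃ λ s → s ∈ˡ a₀ ∷ S × (∃ λ b → R s b ≡ true × ¬ (b ∈ˡ map f S))
  unsaturated f {a₀} {S} uq
    with Any.any? (λ s → Any.any? (λ b → R s b Bool.≟ true ×-dec ¬? (b ∈ᴮ? map f S)) bs) (a₀ ∷ S)
  ... | yes found = let s , s∈ , p = find found ; b , _ , q = find p in s , s∈ , b , q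
  ... | no  none = ⊥-elim (<⇒≱ (*-monoˡ-< (suc d) (≤-refl {suc (length S)})) (begin
    length (a₀ ∷ S) * suc d                 ≤⟨ ∑-≥-* (λ a → ∑ (ι ∘ R a) bs) (suc d) (a₀ ∷ S) row ⟩
    ∑ (λ a → ∑ (ι ∘ R a) bs) (a₀ ∷ S)       ≡⟨ ∑-swap (λ a → ι ∘ R a) (a₀ ∷ S) bs ⟩
    ∑ h bs                                  ≤⟨ ∑-support h bs-unique (map f S) support ⟩
    ∑ h (map f S)                           ≤⟨ ∑-≤-* h (suc d) (map f S) (λ _ → h≤ _) ⟩
    length (map f S) * suc d                ≡⟨ cong (_* suc d) (length-map f S) ⟩
    length S * suc d                        ∎))
    where
    open ≤-Reasoning
    h : B → ℕ
    h b = ∑ (λ a → ι (R a b)) (a₀ ∷ S)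

    h≤ : ∀ b → h b ≤ suc d
    h≤ b = ≤-trans (∑-support (λ a → ι (R a b)) uq (allFin m) (λ _ _ → ∈-allFin _)) (column b)

    support : ∀ {b} → b ∈ˡ bs → 0 < h b → b ∈ˡ map f S
    support {b} b∈ 0<h with b ∈ᴮ? map f S
    ... | yes b∈f = b∈f
    ... | no  b∉f with ∑-positive (λ a → ι (R a b)) (a₀ ∷ S) 0<h
    ...   | s , s∈ , 0<ι = ⊥-elim (none (lose s∈ (lose b∈ (ι-true 0<ι , b∉f))))

  module _ (f : Fin m → B) (a₀ : Fin m) (xs : List (Fin m)) (a₀∉xs : ¬ (a₀ ∈ˡ xs)) (matching : Matching (_∈ˡ xs) f) where

    -- A matching of a₀ ∷ xs that leaves s free, obtained by switching along an alternating path through S.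
    record Freed (S : List (Fin m)) (s : Fin m) : Set where
      field
        g         : Fin m → B
        g-match   : Matching (λ a → a ∈ˡ a₀ ∷ xs × a ≢ s) g
        unchanged : ∀ {a} → a ∈ˡ xs → ¬ (a ∈ˡ S) → g a ≡ f a
        image     : ∀ {a} → a ∈ˡ a₀ ∷ xs → a ≢ s → ∃ λ a′ → a′ ∈ˡ xs × g a ≡ f a′

    open Freed

    private
      _[_↦_] : (Fin m → B) → Fin m → B → Fin m → B
      (g [ s ↦ b ]) a = if does (a Fin.≟ s) then b else g a

      ↦-other : ∀ g {s a} b → a ≢ s → (g [ s ↦ b ]) a ≡ g a
      ↦-other g {s} {a} b a≢s with a Fin.≟ s
      ... | yes a≡s = ⊥-elim (a≢s a≡s)
      ... | no  _   = refl

    -- Used in two ways: with a value `b` outside the image of `f` on `xs`, to complete the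
    -- matching, and with `b` the value of some `s′` left out of `D`, to free `s′`.
    reassign : ∀ {S s b} (F : Freed S s) {D : Fin m → Set} → (∀ {a} → D a → a ∈ˡ a₀ ∷ xs) →
               R s b ≡ true → (∀ {a} → D a → a ≢ s → g F a ≢ b) → Matching D (g F [ s ↦ b ])
    reassign {s = s} {b} F D⊆ Rsb fresh .related {a} Da with a Fin.≟ s
    ... | yes refl = Rsb
    ... | no  a≢s  = related (g-match F) (D⊆ Da , a≢s)
    reassign {s = s} {b} F D⊆ Rsb fresh .injective {a} {a′} Da Da′ eq with a Fin.≟ s | a′ Fin.≟ s
    ... | yes refl | yes refl = refl
    ... | yes refl | no  a′≢s = ⊥-elim (fresh Da′ a′≢s (sym eq))
    ... | no  a≢s  | yes refl = ⊥-elim (fresh Da a≢s eq)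
    ... | no  a≢s  | no  a′≢s = injective (g-match F) (D⊆ Da , a≢s) (D⊆ Da′ , a′≢s) eq

    search : ∀ k S → Unique (a₀ ∷ S) → (∀ {s} → s ∈ˡ S → s ∈ˡ xs) → length xs ≤ k + length S →
             (∀ {s} → s ∈ˡ a₀ ∷ S → Freed S s) → ∃ λ f′ → Matching (_∈ˡ a₀ ∷ xs) f′
    search k S uq@(_ ∷ uqS) S⊆ le freed with unsaturated f uq
    ... | s , s∈ , b , Rsb , b∉fS with b ∈ᴮ? map f xs
    ...   | no b∉fxs = _ , reassign (freed s∈) id Rsb fresh
      where
      fresh : ∀ {a} → a ∈ˡ a₀ ∷ xs → a ≢ s → g (freed s∈) a ≢ b
      -- Away from `s`, the freed matching takes only values of `f` on `xs`, and `b` is none of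
      -- these.
      fresh a∈ a≢s refl with image (freed s∈) a∈ a≢s
      ... | a′ , a′∈ , eq = b∉fxs (subst (_∈ˡ map f xs) (sym eq) (∈-map⁺ f a′∈))
    ...   | yes b∈fxs with ∈-map⁻ f b∈fxs
    ...     | s′ , s′∈ , refl = continue k le
      where
      F : Freed S s
      F = freed s∈

      s′∉S : ¬ (s′ ∈ˡ S)
      s′∉S = b∉fS ∘ ∈-map⁺ f

      a₀≢ : ∀ {a} → a ∈ˡ xs → a₀ ≢ a
      a₀≢ a∈ refl = a₀∉xs a∈

      ≢s : ∀ {a} → a ∈ˡ xs → ¬ (a ∈ˡ S) → a ≢ s
      ≢s = avoid s∈
        where
        avoid : ∀ {s} → s ∈ˡ a₀ ∷ S → ∀ {a} → a ∈ˡ xs → ¬ (a ∈ˡ S) → a ≢ s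
        avoid (here refl) a∈ _   refl = a₀∉xs a∈
        avoid (there s∈S) _  a∉S refl = a∉S s∈S

      fresh : ∀ {a} → a ∈ˡ a₀ ∷ xs × a ≢ s′ → a ≢ s → g F a ≢ f s′
      fresh (a∈ , a≢s′) a≢s eq =
        -- The freed matching still agrees with `f` at `s′`, so a second vertex with this value
        -- would contradict injectivity.
        a≢s′ (injective (g-match F) (a∈ , a≢s) (there s′∈ , ≢s s′∈ s′∉S) (trans eq (sym (unchanged F s′∈ s′∉S))))

      weaken : ∀ {a} → Freed S a → Freed (s′ ∷ S) a
      weaken E = record { g = g E ; g-match = g-match E ; unchanged = λ a∈ a∉ → unchanged E a∈ (a∉ ∘ there) ; image = image E }

      freed′ : ∀ {a} → a ∈ˡ a₀ ∷ s′ ∷ S → Freed (s′ ∷ S) a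
      -- As `s` is related to `f s′`, it takes over that value and `s′` becomes free.
      freed′ (there (here refl)) .g       = g F [ s ↦ f s′ ]
      freed′ (there (here refl)) .g-match = reassign F proj₁ Rsb fresh
      freed′ (there (here refl)) .unchanged a∈ a∉ = trans (↦-other (g F) (f s′) (≢s a∈ (a∉ ∘ there))) (unchanged F a∈ (a∉ ∘ there))
      freed′ (there (here refl)) .image {a} a∈ a≢s′ with a Fin.≟ s
      ... | yes refl = s′ , s′∈ , refl
      ... | no  a≢s  = image F a∈ a≢s
      freed′ (here refl)       = weaken (freed (here refl))
      freed′ (there (there a∈)) = weaken (freed (there a∈))

      S′⊆ : ∀ {a} → a ∈ˡ s′ ∷ S → a ∈ˡ xs
      S′⊆ (here refl) = s′∈
      S′⊆ (there a∈)  = S⊆ a∈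

      uqS′ : Unique (s′ ∷ S)
      uqS′ = All.tabulate (λ a∈ eq → s′∉S (subst (_∈ˡ S) (sym eq) a∈)) ∷ uqS

      continue : ∀ k → length xs ≤ k + length S → ∃ λ f′ → Matching (_∈ˡ a₀ ∷ xs) f′
      -- Without fuel, `S` is at least as long as `xs`, which leaves no room for `s′`.
      continue zero    le = ⊥-elim (<⇒≱ (unique-⊆⇒length≤ uqS′ xs S′⊆) le)
      continue (suc k) le = search k (s′ ∷ S) (All.tabulate (a₀≢ ∘ S′⊆) ∷ uqS′) S′⊆
                              (≤-trans le (≤-reflexive (sym (+-suc k _)))) freed′

    extend-matching : ∃ λ f′ → Matching (_∈ˡ a₀ ∷ xs) f′
    extend-matching = search (length xs) [] ([] ∷ []) (λ ()) (m≤m+n _ _) initial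
      where
      in-xs : ∀ {a} → a ∈ˡ a₀ ∷ xs → a ≢ a₀ → a ∈ˡ xs
      in-xs (here refl) a≢ = ⊥-elim (a≢ refl)
      in-xs (there a∈)  _  = a∈

      initial : ∀ {s} → s ∈ˡ a₀ ∷ [] → Freed [] s
      initial (here refl) = record
        { g         = f
        ; g-match   = record
          { related   = λ (a∈ , a≢) → related matching (in-xs a∈ a≢)
          ; injective = λ (a∈ , a≢) (a′∈ , a′≢) → injective matching (in-xs a∈ a≢) (in-xs a′∈ a′≢) }
        ; unchanged = λ _ _ → refl
        ; image     = λ {a} a∈ a≢ → a , in-xs a∈ a≢ , refl }

  perfect-matching : (Fin m → B) → ∃ λ f → Injective _≡_ _≡_ f × (∀ a → R a (f a) ≡ true)
  perfect-matching f₀ with go (allFin m) (allFin⁺ m)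
    where
    go : ∀ xs → Unique xs → ∃ λ f → Matching (_∈ˡ xs) f
    go []       _         = f₀ , record { related = λ () ; injective = λ () }
    go (x ∷ xs) (x∉ ∷ uq) = let f , match = go xs uq in extend-matching f x xs (λ x∈ → All.lookup x∉ x∈ refl) match
  ... | f , match = f , injective match (∈-allFin _) (∈-allFin _) , λ a → related match (∈-allFin a)

-- Windows of a cyclic order

toℕ-⊕ : ∀ {m} (j : Fin (suc m)) i → toℕ (j ⊕ i) ≡ (toℕ j + i) % suc m
toℕ-⊕ {m} j i = toℕ-fromℕ< (m%n<n (toℕ j + i) (suc m))

⊕-identityʳ : ∀ (j : Fin n) → j ⊕ 0 ≡ j
⊕-identityʳ {suc m} j = toℕ-injective (trans (toℕ-⊕ j 0)
  (trans (cong (_% suc m) (+-identityʳ (toℕ j))) (m<n⇒m%n≡m (toℕ<n j))))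

⊕-assoc : ∀ (j : Fin n) a b → (j ⊕ a) ⊕ b ≡ j ⊕ (a + b)
⊕-assoc {suc m} j a b = toℕ-injective (begin
  toℕ ((j ⊕ a) ⊕ b)                                 ≡⟨ toℕ-⊕ (j ⊕ a) b ⟩
  (toℕ (j ⊕ a) + b) % suc m                         ≡⟨ cong (λ k → (k + b) % suc m) (toℕ-⊕ j a) ⟩
  ((toℕ j + a) % suc m + b) % suc m                 ≡⟨ %-distribˡ-+ ((toℕ j + a) % suc m) b (suc m) ⟩
  ((toℕ j + a) % suc m % suc m + b % suc m) % suc m ≡⟨ cong (λ k → (k + b % suc m) % suc m) (m%n%n≡m%n (toℕ j + a) (suc m)) ⟩
  ((toℕ j + a) % suc m + b % suc m) % suc m         ≡⟨ %-distribˡ-+ (toℕ j + a) b (suc m) ⟨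
  (toℕ j + a + b) % suc m                           ≡⟨ cong (_% suc m) (+-assoc (toℕ j) a b) ⟩
  (toℕ j + (a + b)) % suc m                         ≡⟨ toℕ-⊕ j (a + b) ⟨
  toℕ (j ⊕ (a + b))                                 ∎)
  where open ≡-Reasoning

⊕-transitive : ∀ (j k : Fin n) → ∃ λ i → j ⊕ i ≡ k
-- First the steps that lead from `j` round to 0, then `k` more.
⊕-transitive {suc m} j k = suc m ∸ toℕ j + toℕ k , toℕ-injective (begin
  toℕ (j ⊕ (suc m ∸ toℕ j + toℕ k))           ≡⟨ toℕ-⊕ j _ ⟩
  (toℕ j + (suc m ∸ toℕ j + toℕ k)) % suc m   ≡⟨ cong (_% suc m) (+-assoc (toℕ j) _ _) ⟨
  (toℕ j + (suc m ∸ toℕ j) + toℕ k) % suc m   ≡⟨ cong (λ l → (l + toℕ k) % suc m) (m+[n∸m]≡n (<⇒≤ (toℕ<n j))) ⟩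
  (suc m + toℕ k) % suc m                     ≡⟨ cong (_% suc m) (+-comm (suc m) (toℕ k)) ⟩
  (toℕ k + suc m) % suc m                     ≡⟨ [m+n]%n≡m%n (toℕ k) (suc m) ⟩
  toℕ k % suc m                               ≡⟨ m<n⇒m%n≡m (toℕ<n k) ⟩
  toℕ k                                       ∎)
  where open ≡-Reasoning

module _ (P : Subset n) (∣P∣<n : ∣ P ∣ < n) where

  Window : ℕ → Fin n → Set
  Window s j = ∀ {i} → i < s → j ⊕ i ∈ P

  window? : ∀ s → Decidable (Window s)
  window? s j = allUpTo? (λ i → j ⊕ i ∈? P) s

  windows : ℕ → Subset n
  windows s = ⟦ window? s ⟧

  private
    shift : ∀ {s j} → Window (suc s) j → Window s (j ⊕ 1)
    shift {j = j} win {i} i<s = subst (_∈ P) (sym (⊕-assoc j 1 i)) (win (s≤s i<s))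

    windows⊆P : ∀ s → windows (suc s) ⊆ P
    windows⊆P s {j} j∈ = subst (_∈ P) (⊕-identityʳ j) (∈⟦⟧⁻ (window? (suc s)) j∈ (s≤s z≤n))

    windows-decreasing : ∀ s → windows (suc s) ⊆ windows s
    windows-decreasing s j∈ = ∈⟦⟧⁺ (window? s) λ i<s → ∈⟦⟧⁻ (window? (suc s)) j∈ (m<n⇒m<1+n i<s)

    -- If lengthening the windows loses none of them, the set of windows is invariant
    -- under rotation, hence empty because P is proper.
    stable⇒empty : ∀ s → windows (suc s) ⊆ windows (suc (suc s)) → ∀ j → j ∉ windows (suc s)
    stable⇒empty s stable j j∈ = <⇒≱ ∣P∣<n (≤-trans (≤-reflexive (sym (∣⊤∣≡n n))) (p⊆q⇒∣p∣≤∣q∣ ⊤⊆P))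
      where
      orbit : ∀ i → j ⊕ i ∈ windows (suc s)
      orbit zero    = subst (_∈ windows (suc s)) (sym (⊕-identityʳ j)) j∈
      orbit (suc i) = subst (_∈ windows (suc s)) (trans (⊕-assoc j i 1) (cong (j ⊕_) (+-comm i 1)))
        (∈⟦⟧⁺ (window? (suc s)) (shift (∈⟦⟧⁻ (window? (suc (suc s))) (stable (orbit i)))))
      ⊤⊆P : Subset.⊤ ⊆ P
      ⊤⊆P {k} _ with ⊕-transitive j k
      ... | i , refl = windows⊆P s (orbit i)

  -- There are at most |P| windows of length 1, and by `stable⇒empty` each lengthening loses at
  -- least one while any are left.
  ∣windows∣≤ : ∀ s → ∣ windows (suc s) ∣ ≤ ∣ P ∣ ∸ s
  ∣windows∣≤ zero    = p⊆q⇒∣p∣≤∣q∣ (windows⊆P zero)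
  ∣windows∣≤ (suc s) with ∣ windows (suc s) ∣ ≤? ∣ windows (suc (suc s)) ∣
  ... | no  ≰ = ≤-trans (pred-mono-≤ (≤-trans (≰⇒> ≰) (∣windows∣≤ s))) (≤-reflexive (pred[m∸n]≡m∸[1+n] ∣ P ∣ s))
  ... | yes ≤ = ≤-trans (≤-reflexive (trans (cong ∣_∣ (Empty-unique empty)) (∣⊥∣≡0 n))) z≤n
    where
    empty : Subset.Empty (windows (suc (suc s)))
    empty (j , j∈) = stable⇒empty s (⊆∧∣∣≥⇒⊇ (windows-decreasing (suc s)) ≤) j (windows-decreasing (suc s) j∈)

-- With the default z equal to the head, stepping past the end of the list closes the cycle.
at : ∀ {A : Set} → A → List A → ℕ → A
at z []      k       = z
at z (x ∷ l) zero    = x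
at z (x ∷ l) (suc k) = at z l k

at-∈ : ∀ {A : Set} {z : A} l {k} → k < length l → at z l k ∈ˡ l
at-∈ (x ∷ l) {zero}  _         = here refl
at-∈ (x ∷ l) {suc k} (s≤s k<l) = there (at-∈ l k<l)

at-injective : ∀ {A : Set} {z : A} {l} → Unique l → ∀ {j k} → j < length l → k < length l → at z l j ≡ at z l k → j ≡ k
at-injective {l = x ∷ l} _         {zero}  {zero}  _ _ _  = refl
at-injective {l = x ∷ l} (x∉ ∷ _)  {zero}  {suc k} _ (s≤s k<) eq = ⊥-elim (All.lookup x∉ (at-∈ l k<) eq)
at-injective {l = x ∷ l} (x∉ ∷ _)  {suc j} {zero}  (s≤s j<) _ eq = ⊥-elim (All.lookup x∉ (at-∈ l j<) (sym eq))
at-injective {l = x ∷ l} (_ ∷ uq)  {suc j} {suc k} (s≤s j<) (s≤s k<) eq = cong suc (at-injective uq j< k< eq)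

at-length : ∀ {A : Set} {z : A} l → at z l (length l) ≡ z
at-length []      = refl
at-length (x ∷ l) = at-length l

-- The case `k = length l` is the closing step, which reads the default `z`.
at-gaps : ∀ (G : Graph n) a l z → gaps G a l z ≡ 0 → ∀ k → k ≤ length l →
          at z (a ∷ l) (suc k) ∈ nbr G (at z (a ∷ l) k)
at-gaps G a []      z eq zero    _ = gap≡0⇒∈ G eq
at-gaps G a (b ∷ l) z eq zero    _ = gap≡0⇒∈ G (m+n≡0⇒m≡0 (gap G a b) eq)
at-gaps G a (b ∷ l) z eq (suc k) (s≤s k≤) = at-gaps G b l z (m+n≡0⇒n≡0 (gap G a b) eq) k k≤

hamiltonian⇒cyclic : ∀ (G : Graph n) → Hamiltonian G →
                     ∃ λ (core : Fin n → Fin n) → Injective _≡_ _≡_ core × (∀ j → core (j ⊕ 1) ∈ nbr G (core j))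
hamiltonian⇒cyclic {zero}  G _ = id , id , λ ()
hamiltonian⇒cyclic {suc m} G ([] , perm , _) = case ↭-length perm of λ ()
hamiltonian⇒cyclic {suc m} G (x ∷ l , perm , eq) = core , core-injective , core-adjacent
  where
  length≡ : length (x ∷ l) ≡ suc m
  length≡ = trans (↭-length perm) (length-tabulate (id {A = Fin (suc m)}))

  uq : Unique (x ∷ l)
  uq = ↭ₛ.Unique-resp-↭ (setoid (Fin (suc m))) (↭⇒↭ₛ (↭-sym perm)) (allFin⁺ (suc m))

  core : Fin (suc m) → Fin (suc m)
  core j = at x (x ∷ l) (toℕ j)

  toℕ<length : ∀ (j : Fin (suc m)) → toℕ j < length (x ∷ l)
  toℕ<length j = subst (toℕ j <_) (sym length≡) (toℕ<n j)

  core-injective : Injective _≡_ _≡_ core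
  core-injective {j} {k} = toℕ-injective ∘ at-injective uq (toℕ<length j) (toℕ<length k)

  core-next : ∀ j → core (j ⊕ 1) ≡ at x (x ∷ l) (suc (toℕ j))
  core-next j with suc (toℕ j) <? suc m
  ... | yes lt = cong (at x (x ∷ l)) (trans (toℕ-⊕ j 1) (trans (cong (_% suc m) (+-comm (toℕ j) 1)) (m<n⇒m%n≡m lt)))
  -- At the last position `j ⊕ 1` wraps round to 0, where the list has its head `x`; the other side
  -- runs past the end and yields the default, again `x`.
  ... | no  ≮ = trans (cong (at x (x ∷ l)) (trans (toℕ-⊕ j 1) (trans (cong (_% suc m) (trans (+-comm (toℕ j) 1) last)) (n%n≡0 (suc m)))))
                  (sym (trans (cong (at x (x ∷ l)) (trans last (sym length≡))) (at-length (x ∷ l))))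
    where
    last : suc (toℕ j) ≡ suc m
    last = ≤-antisym (toℕ<n j) (≮⇒≥ ≮)

  core-adjacent : ∀ j → core (j ⊕ 1) ∈ nbr G (core j)
  core-adjacent j = subst (_∈ nbr G (core j)) (sym (core-next j)) (at-gaps G x l x eq (toℕ j) (≤-pred (toℕ<length j)))

-- Families of supersets

superset : ∀ (U : Subset n) r → ∣ U ∣ ≤ r → r ≤ n → ∃ λ e → U ⊆ e × ∣ e ∣ ≡ r
superset []          zero    _         _         = [] , id , refl
superset (true ∷ U)  (suc r) (s≤s U≤r) (s≤s r≤n) = let e , U⊆e , eq = superset U r U≤r r≤n in true ∷ e , in⊆in U⊆e , cong suc eq
superset {suc n} (false ∷ U) r U≤r r≤1+n with r ≤? n
... | yes r≤n = let e , U⊆e , eq = superset U r U≤r r≤n in false ∷ e , out⊆ U⊆e , eq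
... | no  r≰n = Subset.⊤ , ⊆⊤ , trans (∣⊤∣≡n (suc n)) (≤-antisym (≰⇒> r≰n) r≤1+n)

record Supersets (U : Subset n) (r : ℕ) : Set where
  field
    sets   : List (Subset n)
    unique : Unique sets
    ⊇U     : ∀ {e} → e ∈ˡ sets → U ⊆ e
    size   : ∀ {e} → e ∈ˡ sets → ∣ e ∣ ≡ r
    many   : n ≤ length sets + ∣ U ∣

open Supersets

prepend : ∀ {U : Subset n} {r} b → Supersets U r → ∃ λ (F : List (Subset (suc n))) →
          Unique F × (∀ {e} → e ∈ˡ F → ∃ λ e′ → e ≡ b ∷ e′ × U ⊆ e′ × ∣ e′ ∣ ≡ r) × n ≤ length F + ∣ U ∣
prepend {n} {U} {r} b F =
  map (b ∷_) (sets F) , map⁺ ∷-injectiveʳ (unique F) , members ,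
  subst (λ k → n ≤ k + ∣ U ∣) (sym (length-map (b ∷_) (sets F))) (many F)
  where
  members : ∀ {e} → e ∈ˡ map (b ∷_) (sets F) → ∃ λ e′ → e ≡ b ∷ e′ × U ⊆ e′ × ∣ e′ ∣ ≡ r
  members e∈ with ∈-map⁻ (b ∷_) e∈
  ... | e′ , e′∈ , eq = e′ , eq , ⊇U F e′∈ , size F e′∈

-- One set per element outside `U` is enough. Each such element, met in the recursion on the ground
-- set, contributes a set on the other side of it from the sets found recursively.
supersets : ∀ (U : Subset n) r → ∣ U ∣ < r → r < n → Supersets U r
supersets (true ∷ U) (suc r) (s≤s U<r) (s≤s r<n) with prepend true (supersets U r U<r r<n)
... | F , uq , members , le = record
  { sets = F ; unique = uq
  ; ⊇U = λ e∈ → case members e∈ of λ { (_ , refl , U⊆ , _) → in⊆in U⊆ }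
  ; size = λ e∈ → case members e∈ of λ { (_ , refl , _ , eq) → cong suc eq }
  ; many = ≤-trans (s≤s le) (≤-reflexive (sym (+-suc (length F) ∣ U ∣))) }
supersets {suc n} (false ∷ U) (suc r) U<r@(s≤s U≤r) (s≤s r<n) with suc r <? n
-- The recursive family avoids the first element, and one superset containing it is added.
... | yes 1+r<n with prepend false (supersets U (suc r) U<r 1+r<n) | superset U r U≤r (<⇒≤ r<n)
...   | F , uq , members , le | e₀ , U⊆e₀ , eq₀ = record
  { sets   = (true ∷ e₀) ∷ F
  ; unique = All.tabulate (λ e∈ eq → case members e∈ of λ { (_ , refl , _) → case eq of λ () }) ∷ uq
  ; ⊇U     = λ { (here refl) → out⊆ U⊆e₀ ; (there e∈) → case members e∈ of λ { (_ , refl , U⊆ , _) → out⊆ U⊆ } }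
  ; size   = λ { (here refl) → cong suc eq₀ ; (there e∈) → case members e∈ of λ { (_ , refl , _ , eq) → eq } }
  ; many   = s≤s le }
-- Now `n` equals `suc r`, so the only set of the right size that avoids the first element is the
-- whole remainder.
supersets {suc n} (false ∷ U) (suc r) U<r@(s≤s U≤r) (s≤s r<n) | no 1+r≮n with ∣ U ∣ <? r
... | yes ∣U∣<r with prepend true (supersets U r ∣U∣<r r<n)
...   | F , uq , members , le = record
  { sets   = (false ∷ Subset.⊤) ∷ F
  ; unique = All.tabulate (λ e∈ eq → case members e∈ of λ { (_ , refl , _) → case eq of λ () }) ∷ uq
  ; ⊇U     = λ { (here refl) → out⊆ ⊆⊤ ; (there e∈) → case members e∈ of λ { (_ , refl , U⊆ , _) → out⊆ U⊆ } }
  ; size   = λ { (here refl) → trans (∣⊤∣≡n n) (≤-antisym (≮⇒≥ 1+r≮n) r<n) ; (there e∈) → case members e∈ of λ { (_ , refl , _ , eq) → cong suc eq } }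
  ; many   = s≤s le }
-- Here |U| = r and the ground set has |U| + 2 elements, so two sets suffice.
supersets {suc n} (false ∷ U) (suc r) U<r@(s≤s U≤r) (s≤s r<n) | no 1+r≮n | no ∣U∣≮r = record
  { sets   = (false ∷ Subset.⊤) ∷ (true ∷ U) ∷ []
  ; unique = ((λ ()) ∷ []) ∷ [] ∷ []
  ; ⊇U     = λ { (here refl) → out⊆ ⊆⊤ ; (there (here refl)) → out⊆ id }
  ; size   = λ { (here refl) → trans (∣⊤∣≡n n) (≤-antisym (≮⇒≥ 1+r≮n) r<n) ; (there (here refl)) → cong suc (≤-antisym U≤r (≮⇒≥ ∣U∣≮r)) }
  ; many   = s≤s (≤-trans (≮⇒≥ 1+r≮n) (s≤s (≮⇒≥ ∣U∣≮r))) }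

allSubsets : ∀ n → List (Subset n)
allSubsets zero    = [] ∷ []
allSubsets (suc n) = map (true ∷_) (allSubsets n) ++ map (false ∷_) (allSubsets n)

allSubsets-unique : ∀ n → Unique (allSubsets n)
allSubsets-unique zero    = [] ∷ []
allSubsets-unique (suc n) = ++⁺ (map⁺ ∷-injectiveʳ (allSubsets-unique n)) (map⁺ ∷-injectiveʳ (allSubsets-unique n)) disjoint
  where
  disjoint : ∀ {e} → ¬ (e ∈ˡ map (true ∷_) (allSubsets n) × e ∈ˡ map (false ∷_) (allSubsets n))
  disjoint (e∈ , e∈′) with ∈-map⁻ (true ∷_) e∈ | ∈-map⁻ (false ∷_) e∈′
  ... | _ , _ , refl | _ , _ , ()

∈-allSubsets : ∀ (e : Subset n) → e ∈ˡ allSubsets n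
∈-allSubsets []          = here refl
∈-allSubsets (true ∷ e)  = ∈-++⁺ˡ (∈-map⁺ (true ∷_) (∈-allSubsets e))
∈-allSubsets (false ∷ e) = ∈-++⁺ʳ (map (true ∷_) (allSubsets _)) (∈-map⁺ (false ∷_) (∈-allSubsets e))

-- Good sets

ι-mono : ∀ {P Q : Set} (P? : Dec P) (Q? : Dec Q) → (P → Q) → ι (does P?) ≤ ι (does Q?)
ι-mono (no  _) _        _   = z≤n
ι-mono (yes _) (yes _)  _   = ≤-refl
ι-mono (yes p) (no ¬q)  P→Q = ⊥-elim (¬q (P→Q p))

ι-≥1 : ∀ {P : Set} (P? : Dec P) → P → 1 ≤ ι (does P?)
ι-≥1 (yes _) _ = ≤-refl
ι-≥1 (no ¬p) p = ⊥-elim (¬p p)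

ι-≤0 : ∀ {P : Set} (P? : Dec P) → ¬ P → ι (does P?) ≤ 0
ι-≤0 (no  _) _  = z≤n
ι-≤0 (yes p) ¬p = ⊥-elim (¬p p)

does-true : ∀ {P : Set} (P? : Dec P) → does P? ≡ true → P
does-true (yes p) _ = p

∣preimage∣≤ : ∀ (f : Fin n → Fin n) → Injective _≡_ _≡_ f → ∀ e → ∣ ⟦ (λ j → f j ∈? e) ⟧ ∣ ≤ ∣ e ∣
∣preimage∣≤ {n} f inj e = begin
  ∣ P ∣                        ≡⟨ ∑-𝟙 P ⟨
  ∑ (𝟙 P) (allFin n)           ≤⟨ ∑-mono (allFin n) (λ {j} _ → 𝟙-mono j) ⟩
  ∑ (𝟙 e ∘ f) (allFin n)       ≡⟨ ∑-map (𝟙 e) f (allFin n) ⟨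
  ∑ (𝟙 e) (map f (allFin n))   ≤⟨ ∑-support (𝟙 e) (map⁺ inj (allFin⁺ n)) (allFin n) (λ _ _ → ∈-allFin _) ⟩
  ∑ (𝟙 e) (allFin n)           ≡⟨ ∑-𝟙 e ⟩
  ∣ e ∣                        ∎
  where
  open ≤-Reasoning
  P : Subset n
  P = ⟦ (λ j → f j ∈? e) ⟧
  𝟙-mono : ∀ j → 𝟙 P j ≤ 𝟙 e (f j)
  𝟙-mono j with j ∈? P
  ... | no  j∉ = ≤-trans (≤-reflexive (𝟙-∉ j∉)) z≤n
  ... | yes j∈ = ≤-trans (ι≤1 _) (≤-reflexive (sym (𝟙-∈ (∈⟦⟧⁻ (λ j → f j ∈? e) j∈))))

-- Removing the two shared elements from `q` before the union saves both. The additive form avoids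
-- truncated subtraction.
union-sharing-pair : ∀ (p q : Subset n) {a b} → a ∈ p → b ∈ p → a ≢ b → a ∈ q → b ∈ q →
                     ∃ λ U → p ⊆ U × q ⊆ U × 2 + ∣ U ∣ ≤ ∣ p ∣ + ∣ q ∣
union-sharing-pair p q {a} {b} a∈p b∈p a≢b a∈q b∈q = p ∪ q′ , p⊆p∪q q′ , q⊆ , (begin
  2 + ∣ p ∪ q′ ∣        ≤⟨ +-monoʳ-≤ 2 (∣∪∣≤ p q′) ⟩
  2 + (∣ p ∣ + ∣ q′ ∣)  ≡⟨ arith ∣ p ∣ ∣ q′ ∣ ⟩
  ∣ p ∣ + (2 + ∣ q′ ∣)  ≤⟨ +-monoʳ-≤ ∣ p ∣ (≤-trans (s≤s (x∈p⇒∣p-x∣<∣p∣ b∈q-a)) (x∈p⇒∣p-x∣<∣p∣ a∈q)) ⟩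
  ∣ p ∣ + ∣ q ∣         ∎)
  where
  open ≤-Reasoning
  q′ : Subset _
  q′ = q - a - b
  arith : ∀ k l → 2 + (k + l) ≡ k + (2 + l)
  arith = solve-∀
  b∈q-a : b ∈ q - a
  b∈q-a = x∈p∧x≢y⇒x∈p-y b∈q (a≢b ∘ sym)
  q⊆ : q ⊆ p ∪ q′
  q⊆ {x} x∈q with x Fin.≟ a | x Fin.≟ b
  ... | yes refl | _        = x∈p∪q⁺ (inj₁ a∈p)
  ... | no _     | yes refl = x∈p∪q⁺ (inj₁ b∈p)
  ... | no x≢a   | no x≢b   = x∈p∪q⁺ (inj₂ (x∈p∧x≢y⇒x∈p-y (x∈p∧x≢y⇒x∈p-y x∈q x≢a) x≢b))

module _ {r t c : ℕ} (χ : Colouring n r c) where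

  Coloured : Fin c → Subset n → Set
  Coloured i e = Σ (∣ e ∣ ≡ r) λ size → χ (e , size) ≡ i

  coloured? : ∀ i → Decidable (Coloured i)
  coloured? i e with ∣ e ∣ ≟ r
  ... | no  ≢r = no (≢r ∘ proj₁)
  -- An edge carries a proof of its size; as such proofs are unique, its colour depends on the
  -- subset alone.
  ... | yes ≡r = map′ (≡r ,_) (λ (size , eq) → trans (cong (χ ∘ (e ,_)) (≡-irrelevant ≡r size)) eq) (χ (e , ≡r) Fin.≟ i)

  extensions : Fin c → Subset n → ℕ
  extensions i T = ∑ (λ e → ι (does (T ⊆? e ×-dec coloured? i e))) (allSubsets n)

  Good : Fin c → Subset n → Set
  Good i T = suc (r ∸ t) ≤ extensions i T

  good? : ∀ i → Decidable (Good i)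
  good? i T = suc (r ∸ t) ≤? extensions i T

  BadFor : Fin c → Fin n → Fin n → Subset n → Set
  BadFor i u v T = ∣ T ∣ ≤ t × u ∈ T × v ∈ T × ¬ Good i T

  bad? : ∀ i u v → Dec (∃ (BadFor i u v))
  bad? i u v = anySubset? (λ T → ∣ T ∣ ≤? t ×-dec (u ∈? T ×-dec (v ∈? T ×-dec ¬? (good? i T))))

  adjacent? : ∀ i u → Decidable (λ v → u ≢ v × ¬ ∃ (BadFor i u v))
  adjacent? i u v = ¬? (u Fin.≟ v) ×-dec ¬? (bad? i u v)

  goodGraph : Fin c → Graph n
  goodGraph i .nbr u = ⟦ adjacent? i u ⟧
  goodGraph i .nbr-sym {u} {v} v∈ with ∈⟦⟧⁻ (adjacent? i u) v∈
  ... | u≢v , none = ∈⟦⟧⁺ (adjacent? i v) (u≢v ∘ sym , λ (T , size , v∈ , u∈ , bad) → none (T , size , u∈ , v∈ , bad))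
  goodGraph i .nbr-irr {u} u∈ = proj₁ (∈⟦⟧⁻ (adjacent? i u) u∈) refl

  module _ (2≤t : 2 ≤ t) (t<r : t < r) (r<n : r < n) (i : Fin c) (core : Fin n → Fin n)
           (core-injective : Injective _≡_ _≡_ core)
           (core-adjacent : ∀ j → core (j ⊕ 1) ∈ nbr (goodGraph i) (core j)) where

    span : Fin n → ℕ → Subset n
    span j zero    = ⊥
    span j (suc s) = ⁅ core (j ⊕ s) ⁆ ∪ span j s

    ∣span∣≤ : ∀ j s → ∣ span j s ∣ ≤ s
    ∣span∣≤ j zero    = ≤-reflexive (∣⊥∣≡0 n)
    ∣span∣≤ j (suc s) = ≤-trans (∣⁅x⁆∪∣≤ (core (j ⊕ s)) (span j s)) (s≤s (∣span∣≤ j s))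

    ∈span : ∀ j {i s} → i < s → core (j ⊕ i) ∈ span j s
    ∈span j {i} {suc s} (s≤s i≤s) with i ≟ s
    ... | yes refl = x∈p∪q⁺ (inj₁ (x∈⁅x⁆ _))
    ... | no  i≢s  = x∈p∪q⁺ (inj₂ (∈span j (≤∧≢⇒< i≤s i≢s)))

    -- The edge from `core j` to `core (j ⊕ 1)` excludes bad sets containing both; as `2 ≤ t`, the
    -- span of the window contains both.
    span-good : ∀ j → Good i (span j t)
    span-good j = decidable-stable (good? i (span j t)) λ bad →
      proj₂ (∈⟦⟧⁻ (adjacent? i (core j)) (core-adjacent j))
        (span j t , ∣span∣≤ j t ,
         subst (λ k → core k ∈ span j t) (⊕-identityʳ j) (∈span j (≤-trans (s≤s z≤n) 2≤t)) ,
         ∈span j 2≤t , bad)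

    Suitable : Fin n → Subset n → Set
    Suitable j e = (∀ {k} → k < t → core (j ⊕ k) ∈ e) × Coloured i e

    suitable? : ∀ j e → Dec (Suitable j e)
    suitable? j e = allUpTo? (λ k → core (j ⊕ k) ∈? e) t ×-dec coloured? i e

    row : ∀ j → suc (r ∸ t) ≤ ∑ (λ e → ι (does (suitable? j e))) (allSubsets n)
    row j = ≤-trans (span-good j) (∑-mono (allSubsets n) λ {e} _ →
      ι-mono (span j t ⊆? e ×-dec coloured? i e) (suitable? j e) λ (span⊆ , col) → (λ k<t → span⊆ (∈span j k<t)) , col)

    -- The preimage `P` of `e` under `core` has at most `r` < `n` elements, and `e` suits `j` only
    -- if the window of length `t` at `j` lies in `P`. There are at most r - (t - 1) such windows.
    column : ∀ e → ∑ (λ j → ι (does (suitable? j e))) (allFin n) ≤ suc (r ∸ t)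
    column e = by-cases (coloured? i e)
      where
      open ≤-Reasoning
      P : Subset n
      P = ⟦ (λ j → core j ∈? e) ⟧

      by-cases : Dec (Coloured i e) → ∑ (λ j → ι (does (suitable? j e))) (allFin n) ≤ suc (r ∸ t)
      by-cases (no ¬col) = begin
        ∑ (λ j → ι (does (suitable? j e))) (allFin n)  ≤⟨ ∑-mono (allFin n) (λ {j} _ → ι-≤0 (suitable? j e) (¬col ∘ proj₂)) ⟩
        ∑ (λ _ → 0) (allFin n)                         ≡⟨ ∑-zero (allFin n) ⟩
        0                                              ≤⟨ z≤n ⟩
        suc (r ∸ t)                                    ∎
      by-cases (yes (size , _)) = begin
        ∑ (λ j → ι (does (suitable? j e))) (allFin n)  ≤⟨ ∑-mono (allFin n) (λ {j} _ → in-window j) ⟩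
        ∑ (𝟙 (windows P ∣P∣<n t)) (allFin n)           ≡⟨ ∑-𝟙 (windows P ∣P∣<n t) ⟩
        ∣ windows P ∣P∣<n t ∣                          ≡⟨ cong (λ s → ∣ windows P ∣P∣<n s ∣) t≡ ⟨
        ∣ windows P ∣P∣<n (suc (t ∸ 1)) ∣              ≤⟨ ∣windows∣≤ P ∣P∣<n (t ∸ 1) ⟩
        ∣ P ∣ ∸ (t ∸ 1)                                ≤⟨ ∸-monoˡ-≤ (t ∸ 1) ∣P∣≤r ⟩
        r ∸ (t ∸ 1)                                    ≡⟨ cong (λ s → suc r ∸ s) t≡ ⟩
        suc r ∸ t                                      ≡⟨ +-∸-assoc 1 (<⇒≤ t<r) ⟩
        suc (r ∸ t)                                    ∎
        where
        t≡ : suc (t ∸ 1) ≡ t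
        t≡ = m+[n∸m]≡n (≤-trans (s≤s z≤n) 2≤t)

        ∣P∣≤r : ∣ P ∣ ≤ r
        ∣P∣≤r = ≤-trans (∣preimage∣≤ core core-injective e) (≤-reflexive size)

        ∣P∣<n : ∣ P ∣ < n
        ∣P∣<n = ≤-<-trans ∣P∣≤r r<n

        in-window : ∀ j → ι (does (suitable? j e)) ≤ 𝟙 (windows P ∣P∣<n t) j
        in-window j = ≤-trans
          (ι-mono (suitable? j e) (window? P ∣P∣<n t j) (λ (w , _) k<t → ∈⟦⟧⁺ (λ j → core j ∈? e) (w k<t)))
          (≤-reflexive (sym (𝟙-⟦⟧ (window? P ∣P∣<n t) j)))

    goodCycle⇒berge : MonoHamBergeCycle n r t c χ
    goodCycle⇒berge = record
      { colour         = i
      ; core           = core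
      ; edges          = λ j → f j , proj₁ (proj₂ (suitable j))
      ; core-distinct  = core-injective
      ; edges-distinct = λ eq → f-injective (cong proj₁ eq)
      ; tight          = λ j k k<t → proj₁ (suitable j) k<t
      ; mono           = λ j → proj₂ (proj₂ (suitable j)) }
      where
      representatives : ∃ λ f → Injective _≡_ _≡_ f × (∀ j → does (suitable? j (f j)) ≡ true)
      representatives = perfect-matching (≡-dec Bool._≟_) (λ j e → does (suitable? j e)) (allSubsets n)
                          -- The constant `⊥` is an arbitrary starting function for the empty
                          -- matching.
                          (allSubsets-unique n) (r ∸ t) row column (λ _ → ⊥)

      f : Fin n → Subset n
      f = proj₁ representatives

      f-injective : Injective _≡_ _≡_ f
      f-injective = proj₁ (proj₂ representatives)

      suitable : ∀ j → Suitable j (f j)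
      suitable j = does-true (suitable? j (f j)) (proj₂ (proj₂ representatives) j)

  bad-set : ∀ {i W} → Covers (goodGraph i) W → ∃ λ T → ∣ T ∣ ≤ t × ¬ Good i T ×
            (∃ λ a → ∃ λ b → a ∈ W × b ∈ W × a ≢ b × a ∈ T × b ∈ T)
  bad-set {i} (covers a b a∈ b∈ a≢b b∉) =
    let T , size , a∈T , b∈T , bad = decidable-stable (bad? i a b) (λ none → b∉ (∈⟦⟧⁺ (adjacent? i a) (a≢b , none)))
    in T , size , bad , a , b , a∈ , b∈ , a≢b , a∈T , b∈T

  BadWithin : Subset n → Fin c → Set
  BadWithin U i = ∃ λ T → T ⊆ U × ¬ Good i T

  BadWithin-⊆ : ∀ {U V i} → U ⊆ V → BadWithin U i → BadWithin V i
  BadWithin-⊆ {U} {V} U⊆V (T , T⊆U , bad) = T , ⊆-trans {i = T} {j = U} {k = V} T⊆U U⊆V , bad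

  -- A bad set for `i` shares two vertices of `W` with the union built so far and thus adds at most
  -- `t ∸ 2` new ones.
  bad-union : 2 ≤ t → ∀ W → (∀ i → Covers (goodGraph i) W) → ∀ J →
              ∃ λ U → W ⊆ U × ∣ U ∣ ≤ ∣ W ∣ + length J * (t ∸ 2) ×
                All (BadWithin U) J
  bad-union 2≤t W cov []      = W , id , ≤-reflexive (sym (+-identityʳ ∣ W ∣)) , []
  bad-union 2≤t W cov (i ∷ J)
    with bad-union 2≤t W cov J | bad-set (cov i)
  ... | U , W⊆U , size , bads | T , ∣T∣≤t , bad , a , b , a∈ , b∈ , a≢b , a∈T , b∈T
    with union-sharing-pair U T (W⊆U a∈) (W⊆U b∈) a≢b a∈T b∈T
  ... | V , U⊆V , T⊆V , size′ = V , (λ x∈ → U⊆V (W⊆U x∈)) , +-cancelˡ-≤ 2 _ _ (begin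
    2 + ∣ V ∣                                     ≤⟨ size′ ⟩
    ∣ U ∣ + ∣ T ∣                                 ≤⟨ +-mono-≤ size ∣T∣≤t ⟩
    ∣ W ∣ + length J * (t ∸ 2) + t                ≡⟨ cong (∣ W ∣ + length J * (t ∸ 2) +_) (m+[n∸m]≡n 2≤t) ⟨
    ∣ W ∣ + length J * (t ∸ 2) + (2 + (t ∸ 2))    ≡⟨ arith ∣ W ∣ (length J * (t ∸ 2)) (t ∸ 2) ⟩
    2 + (∣ W ∣ + (t ∸ 2 + length J * (t ∸ 2)))    ∎) ,
    (T , T⊆V , bad) ∷ All.map (BadWithin-⊆ U⊆V) bads
    where
    open ≤-Reasoning
    arith : ∀ w l s → w + l + (2 + s) ≡ 2 + (w + (s + l))
    arith = solve-∀

  -- Each of at least n - |U| supersets of `U` contains the bad set of its own colour, and that bad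
  -- set lies in at most `r ∸ t` edges of this colour.
  bad-union-large : ∀ U → ∣ U ∣ < r → r < n → (∀ i → BadWithin U i) → n ≤ c * (r ∸ t) + ∣ U ∣
  bad-union-large U U<r r<n bad = ≤-trans (many F) (+-monoˡ-≤ ∣ U ∣ (begin
    length (sets F)                                                    ≡⟨ ∑-one (sets F) ⟨
    ∑ (λ _ → 1) (sets F)                                               ≤⟨ ∑-mono (sets F) some-colour ⟩
    ∑ (λ e → ∑ (λ i → ι (does (coloured? i e))) (allFin c)) (sets F)   ≡⟨ ∑-swap (λ e i → ι (does (coloured? i e))) (sets F) (allFin c) ⟩
    ∑ (λ i → ∑ (λ e → ι (does (coloured? i e))) (sets F)) (allFin c)   ≤⟨ ∑-≤-* _ (r ∸ t) (allFin c) (λ {i} _ → few i) ⟩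
    length (allFin c) * (r ∸ t)                                        ≡⟨ cong (_* (r ∸ t)) (length-tabulate (id {A = Fin c})) ⟩
    c * (r ∸ t)                                                        ∎))
    where
    open ≤-Reasoning
    F : Supersets U r
    F = supersets U r U<r r<n

    some-colour : ∀ {e} → e ∈ˡ sets F → 1 ≤ ∑ (λ i → ι (does (coloured? i e))) (allFin c)
    some-colour {e} e∈ = ≤-trans (ι-≥1 (coloured? i e) (size F e∈ , refl)) (∑-∈ (λ i → ι (does (coloured? i e))) (∈-allFin i))
      where
      i : Fin c
      i = χ (e , size F e∈)

    few : ∀ i → ∑ (λ e → ι (does (coloured? i e))) (sets F) ≤ r ∸ t
    few i = let T , T⊆U , bad-T = bad i in begin
      ∑ (λ e → ι (does (coloured? i e))) (sets F)
        ≤⟨ ∑-mono (sets F) (λ {e} e∈ → ι-mono (coloured? i e) (T ⊆? e ×-dec coloured? i e)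
                                       (λ col → (λ x∈ → ⊇U F e∈ (T⊆U x∈)) , col)) ⟩
      ∑ (λ e → ι (does (T ⊆? e ×-dec coloured? i e))) (sets F)        ≤⟨ ∑-support _ (unique F) (allSubsets n) (λ _ _ → ∈-allSubsets _) ⟩
      extensions i T                                                  ≤⟨ ≤-pred (≰⇒> bad-T) ⟩
      r ∸ t                                                           ∎

-- The final count against the number of vertices.

bounded-colours : ∀ (r t c n : ℕ) → 2 ≤ t → t < r → 1 ≤ c → c * suc (t ∸ 2) ≤ r ∸ 2 →
                  (r ∸ 1) * c + 2 ≤ n → (χ : Colouring n r c) → MonoHamBergeCycle n r t c χ
bounded-colours r t c n@(suc (suc _)) 2≤t t<r 1≤c c*[t-1]≤r-2 n-large χ =
  [ from-cycle , (λ (W , ∣W∣≤ , cov) → ⊥-elim (no-cover W ∣W∣≤ cov)) ]′ (hamiltonian⊎covers G)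
  where
  open ≤-Reasoning

  G : Fin c → Graph n
  G = goodGraph {t = t} χ

  2≤r : 2 ≤ r
  2≤r = ≤-trans 2≤t (<⇒≤ t<r)

  r<n : r < n
  r<n = begin-strict
    r                    ≡⟨ m+[n∸m]≡n (≤-trans (s≤s z≤n) 2≤r) ⟨
    1 + (r ∸ 1)          ≡⟨ +-comm 1 (r ∸ 1) ⟩
    (r ∸ 1) + 1          <⟨ +-monoʳ-< (r ∸ 1) ≤-refl ⟩
    (r ∸ 1) + 2          ≡⟨ cong (_+ 2) (*-identityʳ (r ∸ 1)) ⟨
    (r ∸ 1) * 1 + 2      ≤⟨ +-monoˡ-≤ 2 (*-monoʳ-≤ (r ∸ 1) 1≤c) ⟩
    (r ∸ 1) * c + 2      ≤⟨ n-large ⟩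
    n                    ∎

  from-cycle : (∃ λ i → Hamiltonian (G i)) → MonoHamBergeCycle n r t c χ
  from-cycle (i , ham) =
    let core , inj , adj = hamiltonian⇒cyclic (G i) ham
    in goodCycle⇒berge {t = t} χ 2≤t t<r r<n i core inj adj

  r-1≡ : r ∸ t + suc (t ∸ 2) ≡ r ∸ 1
  r-1≡ = trans (cong (r ∸ t +_) (sym (+-∸-assoc 1 2≤t)))
           (trans (sym (+-∸-assoc (r ∸ t) (≤-trans (s≤s z≤n) 2≤t))) (cong (_∸ 1) (m∸n+n≡m (<⇒≤ t<r))))

  arith₁ : ∀ c s → suc c + c * s ≡ suc (c * suc s)
  arith₁ = solve-∀

  arith₂ : ∀ c x y → suc (c * x + suc (c * y)) ≡ (x + y) * c + 2
  arith₂ = solve-∀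

  no-cover : ∀ W → ∣ W ∣ ≤ suc c → ¬ (∀ i → Covers (G i) W)
  no-cover W ∣W∣≤ cov =
    let U , _ , size , bads = bad-union {t = t} χ 2≤t W cov (allFin c)
        ∣U∣≤ = bound U size
    in <⇒≱ (too-few U ∣U∣≤) (bad-union-large {t = t} χ U (small U ∣U∣≤) r<n (λ i → All.lookup bads (∈-allFin i)))
    where
    bound : ∀ U → ∣ U ∣ ≤ ∣ W ∣ + length (allFin c) * (t ∸ 2) → ∣ U ∣ ≤ suc (c * suc (t ∸ 2))
    bound U size = begin
      ∣ U ∣                                      ≤⟨ size ⟩
      ∣ W ∣ + length (allFin c) * (t ∸ 2)        ≡⟨ cong (λ k → ∣ W ∣ + k * (t ∸ 2)) (length-tabulate (id {A = Fin c})) ⟩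
      ∣ W ∣ + c * (t ∸ 2)                        ≤⟨ +-monoˡ-≤ (c * (t ∸ 2)) ∣W∣≤ ⟩
      suc c + c * (t ∸ 2)                        ≡⟨ arith₁ c (t ∸ 2) ⟩
      suc (c * suc (t ∸ 2))                      ∎

    small : ∀ U → ∣ U ∣ ≤ suc (c * suc (t ∸ 2)) → ∣ U ∣ < r
    small U ∣U∣≤ = begin
      suc ∣ U ∣                      ≤⟨ s≤s ∣U∣≤ ⟩
      -- The bound on the number of colours ensures that `U` is smaller than an edge, as the family
      -- of supersets requires.
      2 + c * suc (t ∸ 2)            ≤⟨ +-monoʳ-≤ 2 c*[t-1]≤r-2 ⟩
      2 + (r ∸ 2)                    ≡⟨ m+[n∸m]≡n 2≤r ⟩
      r                              ∎

    too-few : ∀ U → ∣ U ∣ ≤ suc (c * suc (t ∸ 2)) → c * (r ∸ t) + ∣ U ∣ < n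
    too-few U ∣U∣≤ = begin
      suc (c * (r ∸ t) + ∣ U ∣)                          ≤⟨ s≤s (+-monoʳ-≤ (c * (r ∸ t)) ∣U∣≤) ⟩
      -- With x = r - t and y = t - 1 this becomes (r - 1)c + 2, exactly the assumed lower bound on
      -- `n`.
      suc (c * (r ∸ t) + suc (c * suc (t ∸ 2)))          ≡⟨ arith₂ c (r ∸ t) (suc (t ∸ 2)) ⟩
      (r ∸ t + suc (t ∸ 2)) * c + 2                      ≡⟨ cong (λ k → k * c + 2) r-1≡ ⟩
      (r ∸ 1) * c + 2                                    ≤⟨ n-large ⟩
      n                                                  ∎
bounded-colours r t c zero       _ _ _ _ n-large _ = ⊥-elim (n≮0 (m+n≤o⇒n≤o ((r ∸ 1) * c) n-large))
bounded-colours r t c (suc zero) _ _ _ _ n-large _ = ⊥-elim (<⇒≱ ≤-refl (m+n≤o⇒n≤o ((r ∸ 1) * c) n-large))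

theorem2p2 : ∀ (r t n : ℕ) → 2 ≤ t → t < r
    → (r ∸ 1) * numColours r t + 2 ≤ n
    → (χ : Colouring n r (numColours r t))
    → MonoHamBergeCycle n r t (numColours r t) χ
theorem2p2 r t n 2≤t t<r = bounded-colours r t (numColours r t) n 2≤t t<r
  -- Two facts about the floor enter: it is positive because t - 1 ≤ r - 2, and its product with t -
  -- 1 is at most r - 2.
  (m≥n⇒m/n>0 {r ∸ 2} {suc (t ∸ 2)} (≤-trans (≤-reflexive (sym (+-∸-assoc 1 2≤t))) (∸-monoˡ-≤ 2 t<r)))
  (m/n*n≤m (r ∸ 2) (suc (t ∸ 2)))
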